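{- Let $n\in\mathbb{N}$, let $\lambda,\mu\in\mathbb{Z}^n$, and let $\mathbf{x}\in GT(\lambda,\mu)$ have tiling $\mathscr{P}$ containing $s$ free tiles, with tiling matrix $A_{\mathscr{P}}$. Then the following conditions are equivalent: (a) $\mathbf{x}$ is a vertex of $GT(\lambda,\mu)$; (b) $A_{\mathscr{P}}$ (as a linear map on $\mathbb{R}^s$) has trivial kernel; i.e., for some $s\times s$ submatrix $\tilde A$ of $A_{\mathscr{P}}$, $\det\tilde A\neq 0$.
   Context: For $n\in\mathbb{N}$, $X_n$ is the real vector space of all triangular arrays $(x_{ij})_{1\le i\le j\le n}$ with $x_{ij}\in\mathbb{R}$, so $X_n \cong \mathbb{R}^{n(n+1)/2}$. For fixed $j$, the entries $x_{1j},\dots,x_{jj}$ form the $j$th row; the $n$th row is the top row and $x_{11}$ is the bottom row. A Gelfand--Tsetlin pattern (GT-pattern) is an array $(x_{ij})_{1\le i\le j\le n}\in X_n$ with $x_{ij}\ge 0$ for $1\le i\le j\le n$ and $x_{i,j+1}\ge x_{ij}\ge x_{i+1,j+1}$ for $1\le i\le j\le n-1$. For $\lambda,\mu\in\mathbb{Z}^n$, the Gelfand--Tsetlin polytope (GT-polytope) $GT(\lambda,\mu)\subset X_n$ is the convex polytope of all GT-patterns $(x_{ij})$ with $x_{in}=\lambda_i$ for $1\le i\le n$, $x_{11}=\mu_1$, and $\sum_{i=1}^{j}x_{ij}-\sum_{i=1}^{j-1}x_{i,j-1}=\mu_j$ for $2\le j\le n$. The tiling $\mathscr{P}$ of a GT-pattern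 $\mathbf{x}\in X_n$ is the partition of $\{(i,j)\in\mathbb{Z}^2: 1\le i\le j\le n\}$ into subsets, called tiles, obtained by grouping together entries that are equal and adjacent: two pairs $(i,j),(\tilde i,\tilde j)$ in this index set are in the same tile iff there is a sequence of pairs $(i,j)=(i_1,j_1),(i_2,j_2),\dots,(i_r,j_r)=(\tilde i,\tilde j)$ in the index set such that, for each $k\in\{1,\dots,r-1\}$, $x_{i_{k+1}j_{k+1}}=x_{i_kj_k}$ and $(i_{k+1},j_{k+1})\in\{(i_k+1,j_k+1),(i_k,j_k+1),(i_k-1,j_k-1),(i_k,j_k-1)\}$. The free tiles $P_1,\dots,P_s$ of $\mathscr{P}$ are the tiles that do not contain $(1,1)$ and do not contain $(i,n)$ for any $1\le i\le n$ (the order of indexing is immaterial). The tiling matrix $A_{\mathscr{P}}=(a_{jk})_{2\le j\le n-1,\,1\le k\le s}$ is defined by $a_{jk}=\#\{i:(i,j)\in P_k\}$. When $s=0$, the kernel is trivial and the determinant of the empty matrix is $1$. -}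

module Defs where

open import Level using (0ℓ)
open import Algebra.Bundles using (CommutativeRing)
open import Algebra.Core using (Op₁; Op₂)
open import Algebra.Structures using (IsCommutativeRing)
open import Data.Fin.Base as Fin using (Fin; zero; suc; toℕ; punchIn)
open import Data.Fin.Properties using (toℕ<n; toℕ≤n)
open import Data.Integer.Base using (ℤ; +_; -[1+_])
open import Data.Nat.Base as ℕ using (ℕ; zero; suc; z≤n; s≤s; _∸_)
open import Data.Nat.Properties using (≤-refl)
open import Data.Product.Base using (∃-syntax; Σ-syntax; _×_)
open import Data.Sum.Base using (_⊎_)
open import Data.Vec.Base using (allFin; count)
open import Data.Vec.Functional using (Vector)
open import Relation.Binary.Bundles using (DecTotalOrder)
open import Relation.Binary.Construct.Closure.ReflexiveTransitive using (Star)
open import Relation.Binary.Core using (Rel; _Preserves_⟶_)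
open import Relation.Binary.PropositionalEquality.Core using (_≡_)
open import Relation.Binary.Structures using (IsDecTotalOrder)
open import Relation.Nullary.Negation.Core using (¬_)
open import Relation.Unary using (Pred; Decidable; _∈_; _≐_; Satisfiable)

import Algebra.Properties.Semiring.Exp as Exp
import Algebra.Properties.Semiring.Mult as Mult
import Algebra.Properties.Semiring.Sum as Sum
import Relation.Binary.Construct.NonStrictToStrict as NonStrictToStrict

-- The real numbers, given by the usual axioms of a Dedekind-complete ordered
-- field, which determine them up to isomorphism.  They are the classical
-- reals: the order (and hence equality) is decidable.
record RealNumbers : Set₁ where
  infix  8 -_
  infixl 7 _*_
  infixl 6 _+_
  infix  4 _≈_ _≤_
  field
    Carrier           : Set
    _≈_ _≤_           : Rel Carrier 0ℓ
    _+_ _*_           : Op₂ Carrier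
    -_                : Op₁ Carrier
    0# 1#             : Carrier
    isCommutativeRing : IsCommutativeRing _≈_ _+_ _*_ -_ 0# 1#
    0≉1               : ¬ 0# ≈ 1#
    *-inverse         : ∀ a → ¬ a ≈ 0# → ∃[ b ] a * b ≈ 1#
    isDecTotalOrder   : IsDecTotalOrder _≈_ _≤_
    +-monoʳ-≤         : ∀ c {a b} → a ≤ b → c + a ≤ c + b
    *-nonNeg          : ∀ {a b} → 0# ≤ a → 0# ≤ b → 0# ≤ a * b

  UpperBound : Pred Carrier 0ℓ → Pred Carrier 0ℓ
  UpperBound S b = ∀ {a} → a ∈ S → a ≤ b

  field
    supremum : (S : Pred Carrier 0ℓ) → Satisfiable S → Satisfiable (UpperBound S) →
               ∃[ b ] b ∈ UpperBound S × (∀ {c} → c ∈ UpperBound S → b ≤ c)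

  commutativeRing : CommutativeRing 0ℓ 0ℓ
  commutativeRing = record { isCommutativeRing = isCommutativeRing }

  decTotalOrder : DecTotalOrder 0ℓ 0ℓ 0ℓ
  decTotalOrder = record { isDecTotalOrder = isDecTotalOrder }

  open CommutativeRing commutativeRing public using (_-_; semiring)
  open NonStrictToStrict _≈_ _≤_ public using (_<_)

-- The pairs (i , j) with 1 ≤ i ≤ j ≤ n, where i is `pos` and j is `row`.
record Index (n : ℕ) : Set where
  constructor index
  field
    pos row  : ℕ
    .1≤pos   : 1 ℕ.≤ pos
    .pos≤row : pos ℕ.≤ row
    .row≤n   : row ℕ.≤ n

open Index public

-- The pair (i + 1 , j): elements of Fin j count from 0, positions from 1.
entry : ∀ {n j} → .(j ℕ.≤ n) → Fin j → Index n
entry {j = j} j≤n i = index (suc (toℕ i)) j (s≤s z≤n) (toℕ<n i) j≤n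

-- q = (i , j + 1), resp. q = (i + 1 , j + 1), when p = (i , j).
_↖_ _↗_ : ∀ {n} → Rel (Index n) 0ℓ
p ↖ q = pos q ≡ pos p × row q ≡ suc (row p)
p ↗ q = pos q ≡ suc (pos p) × row q ≡ suc (row p)

Adjacent : ∀ {n} → Rel (Index n) 0ℓ
Adjacent p q = p ↗ q ⊎ p ↖ q ⊎ q ↗ p ⊎ q ↖ p

tilingRow≤n : ∀ {n} (r : Fin (n ∸ 2)) → 2 ℕ.+ toℕ r ℕ.≤ n
tilingRow≤n {suc (suc n)} r = s≤s (s≤s (toℕ≤n r))

module GelfandTsetlin (ℝ : RealNumbers) where

  open RealNumbers ℝ
  open Exp semiring using (_^_)
  open Mult semiring using () renaming (_×_ to _·_)
  open Sum semiring using (sum-syntax)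

  fromℕ : ℕ → Carrier
  fromℕ m = m · 1#

  fromℤ : ℤ → Carrier
  fromℤ (+ m)    = fromℕ m
  fromℤ -[1+ m ] = - fromℕ (suc m)

  Matrix : ℕ → ℕ → Set
  Matrix m s = Fin m → Fin s → Carrier

  -- Expansion along the first row.
  det : ∀ {s} → Matrix s s → Carrier
  det {zero}  M = 1#
  det {suc s} M =
    ∑[ k < suc s ] ((- 1#) ^ toℕ k * (M zero k * det (λ i l → M (suc i) (punchIn k l))))

  TrivialKernel : ∀ {m s} → Matrix m s → Set
  TrivialKernel {s = s} M =
    (v : Vector Carrier s) → (∀ r → ∑[ k < s ] (M r k * v k) ≈ 0#) → ∀ k → v k ≈ 0#

  -- An s × s submatrix of a matrix with s columns amounts to a choice of s rows,
  -- kept in their original order.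
  HasNonsingularMaximalSubmatrix : ∀ {m s} → Matrix m s → Set
  HasNonsingularMaximalSubmatrix {m} {s} M =
    Σ[ ρ ∈ (Fin s → Fin m) ] ρ Preserves Fin._<_ ⟶ Fin._<_ × ¬ det (λ i k → M (ρ i) k) ≈ 0#

  X : ℕ → Set
  X n = Index n → Carrier

  infix 4 _≋_
  _≋_ : ∀ {n} → Rel (X n) 0ℓ
  x ≋ y = ∀ p → x p ≈ y p

  -- Vertices of a convex polytope are its extreme points.
  IsVertex : ∀ {n} → Pred (X n) 0ℓ → Pred (X n) 0ℓ
  IsVertex P x = x ∈ P ×
    (∀ {y z t} → y ∈ P → z ∈ P → 0# < t → t < 1# →
     x ≋ (λ p → (1# - t) * y p + t * z p) → y ≋ x × z ≋ x)

  record IsGTPattern {n} (x : X n) : Set where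
    field
      nonNeg : ∀ p → 0# ≤ x p
      upper  : ∀ {p q} → p ↖ q → x p ≤ x q
      lower  : ∀ {p q} → p ↗ q → x q ≤ x p

  rowSum : ∀ {n} → X n → (j : ℕ) → .(j ℕ.≤ n) → Carrier
  rowSum x j j≤n = ∑[ i < j ] x (entry j≤n i)

  -- In `weight` the row below the bottom row is empty with sum 0, so that for
  -- the bottom row the condition reads x₁₁ = μ₁.
  record GT {n} (Λ μ : Vector ℤ n) (x : X n) : Set where
    field
      isGTPattern : IsGTPattern x
      top         : ∀ i → x (entry ≤-refl i) ≈ fromℤ (Λ i)
      weight      : ∀ j → rowSum x (suc (toℕ j)) (toℕ<n j) - rowSum x (toℕ j) (toℕ≤n j)
                          ≈ fromℤ (μ j)

  SameTile : ∀ {n} → X n → Rel (Index n) 0ℓ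
  SameTile x = Star (λ p q → x q ≈ x p × Adjacent p q)

  IsTile : ∀ {n} → X n → Pred (Pred (Index n) 0ℓ) 0ℓ
  IsTile x T = ∃[ p ] T ≐ SameTile x p

  IsFree : ∀ {n} → Pred (Pred (Index n) 0ℓ) 0ℓ
  IsFree {n} T = ∀ {p} → p ∈ T → ¬ (pos p ≡ 1 × row p ≡ 1) × ¬ row p ≡ n

  -- A listing, without repetition, of all the free tiles of the tiling of x.
  record FreeTiles {n} (x : X n) (s : ℕ) : Set₁ where
    field
      tile     : Fin s → Pred (Index n) 0ℓ
      tile?    : ∀ k → Decidable (tile k)
      isTile   : ∀ k → IsTile x (tile k)
      isFree   : ∀ k → IsFree (tile k)
      distinct : ∀ {k l} → tile k ≐ tile l → k ≡ l
      complete : ∀ {T} → IsTile x T → IsFree T → ∃[ k ] T ≐ tile k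

  -- Row r of the matrix belongs to row j = r + 2 of the pattern, 2 ≤ j ≤ n - 1.
  tilingMatrix : ∀ {n s} {x : X n} → FreeTiles x s → Matrix (n ∸ 2) s
  tilingMatrix 𝒫 r k =
    fromℕ (count (λ i → tile? k (entry (tilingRow≤n r) i)) (allFin (2 ℕ.+ toℕ r)))
    where open FreeTiles 𝒫

-- If x = (1 - t) y + t z with y, z in GT(λ, μ), each inequality of GT(λ, μ) tight at x is tight at y,
-- so y - x is constant on the tiles of x, zero on the top row, and has zero row sums.  Such a
-- "direction" vanishes off the free tiles, and its values on them are a kernel vector of the tiling
-- matrix.  Conversely a kernel vector v, spread over the free tiles, is a direction d, and x ± ε d lies
-- in GT(λ, μ) for small ε > 0; so x is a vertex only if v = 0.
--
-- For the determinants, maximal minors are alternating multilinear in the columns, so they are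
-- unchanged by adding multiples of columns to one another, as is triviality of the kernel.  Such
-- operations clear the first row except for its first entry, which allows induction on the rows.

module Submission where

open import Defs
open import Level using (0ℓ)
open import Algebra.Bundles using (CommutativeRing)
open import Algebra.Solver.Ring.AlmostCommutativeRing using (fromCommutativeRing; _-Raw-AlmostCommutative⟶_)
open import Data.Bool.Base using (true; false; if_then_else_)
open import Data.Fin.Base as Fin using (Fin; zero; suc; toℕ; fromℕ<; punchIn)
open import Data.Fin.Properties using (toℕ<n; toℕ≤n; toℕ≤pred[n]; toℕ-fromℕ<; punchInᵢ≢i; any?)
open import Data.Integer.Base as ℤ using (ℤ; +_; -[1+_]; _⊖_)
open import Data.Nat.Base as ℕ using (ℕ; zero; suc; z≤n; s≤s; _∸_)
open import Data.Product.Base using (∃-syntax; Σ-syntax; _×_; _,_; proj₁; proj₂)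
open import Data.Sum.Base using (inj₁; inj₂)
open import Data.Unit.Base using (⊤; tt)
open import Data.Vec.Base using (count; tabulate)
open import Data.Vec.Functional using (Vector; _∷_; head; tail)
open import Function.Base using (_∘_; id)
open import Function.Bundles using (_⇔_; mk⇔)
open import Relation.Binary.Bundles using (DecTotalOrder)
open import Relation.Binary.Construct.Closure.ReflexiveTransitive using (_◅_; _◅◅_; reverse) renaming (ε to nil)
open import Relation.Binary.Core using (_Preserves_⟶_)
open import Relation.Binary.Consequences using (dec⇒weaklyDec)
open import Relation.Binary.PropositionalEquality.Core as ≡ using (_≡_)
open import Relation.Nullary using (¬_; Dec; does; yes; no; contradiction; contradiction-irr)
open import Relation.Nullary.Decidable using (recompute; decidable-stable)
open import Relation.Unary using (Pred; Decidable; _∈_)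

import Algebra.Properties.Ring
import Algebra.Properties.Semiring.Mult.TCOptimised
import Algebra.Properties.Semiring.Sum
import Algebra.Solver.Ring
import Data.Integer.Properties as ℤ
import Data.Nat.Properties as ℕ
import Data.Maybe.Base as Maybe
import Relation.Binary.Reasoning.Setoid

-- Solving ring identities with integer coefficients.

module IntegerSolver (R : CommutativeRing 0ℓ 0ℓ) where
  open CommutativeRing R
  open Algebra.Properties.Ring ring
  open Algebra.Properties.Semiring.Mult.TCOptimised semiring using (1+×; ×-homo-+; ×1-homo-*)
    renaming (_×_ to _·_)
  open Relation.Binary.Reasoning.Setoid setoid

  -- The optimised multiple makes `1 · 1#` reduce to `1#`, so in solver equations `con (+ 1)` and
  -- `con (ℤ.- + 1)` denote `1#` and `- 1#` definitionally.
  ⟦_⟧ℤ : ℤ → Carrier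
  ⟦ + n      ⟧ℤ = n · 1#
  ⟦ -[1+ n ] ⟧ℤ = - (suc n · 1#)

  ⟦⟧-⊖ : ∀ m n → ⟦ m ⊖ n ⟧ℤ ≈ m · 1# - n · 1#
  ⟦⟧-⊖ zero    zero    = sym (-‿inverseʳ 0#)
  ⟦⟧-⊖ zero    (suc n) = sym (+-identityˡ _)
  ⟦⟧-⊖ (suc m) zero    = sym (trans (+-congˡ -0#≈0#) (+-identityʳ _))
  ⟦⟧-⊖ (suc m) (suc n) = begin
    ⟦ suc m ⊖ suc n ⟧ℤ             ≡⟨ ≡.cong ⟦_⟧ℤ (ℤ.[1+m]⊖[1+n]≡m⊖n m n) ⟩
    ⟦ m ⊖ n ⟧ℤ                     ≈⟨ ⟦⟧-⊖ m n ⟩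
    m · 1# - n · 1#                ≈⟨ +-identityˡ _ ⟨
    0# + (m · 1# - n · 1#)         ≈⟨ +-congʳ (-‿inverseʳ 1#) ⟨
    (1# - 1#) + (m · 1# - n · 1#)  ≈⟨ interchange 1# (- 1#) (m · 1#) (- (n · 1#)) ⟩
    (1# + m · 1#) + (- 1# - n · 1#) ≈⟨ +-congˡ (-‿+-comm 1# (n · 1#)) ⟩
    (1# + m · 1#) - (1# + n · 1#)  ≈⟨ +-cong (1+× m 1#) (-‿cong (1+× n 1#)) ⟨
    suc m · 1# - suc n · 1#        ∎
    where open import Algebra.Properties.CommutativeSemigroup +-commutativeSemigroup using (interchange)

  ⟦⟧-neg : ∀ i → ⟦ ℤ.- i ⟧ℤ ≈ - ⟦ i ⟧ℤ
  ⟦⟧-neg (+ zero)  = sym -0#≈0#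
  ⟦⟧-neg (+ suc n) = refl
  ⟦⟧-neg -[1+ n ]  = sym (-‿involutive _)

  ⟦⟧-+ : ∀ i j → ⟦ i ℤ.+ j ⟧ℤ ≈ ⟦ i ⟧ℤ + ⟦ j ⟧ℤ
  ⟦⟧-+ (+ m)    (+ n)    = ×-homo-+ 1# m n
  ⟦⟧-+ (+ m)    -[1+ n ] = ⟦⟧-⊖ m (suc n)
  ⟦⟧-+ -[1+ m ] (+ n)    = trans (⟦⟧-⊖ n (suc m)) (+-comm _ _)
  ⟦⟧-+ -[1+ m ] -[1+ n ] = begin
    ⟦ -[1+ m ] ℤ.+ -[1+ n ] ⟧ℤ        ≡⟨ ≡.cong ⟦_⟧ℤ (ℤ.neg-distrib-+ (+ suc m) (+ suc n)) ⟨
    ⟦ ℤ.- (+ (suc m ℕ.+ suc n)) ⟧ℤ    ≈⟨ -‿cong (×-homo-+ 1# (suc m) (suc n)) ⟩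
    - (suc m · 1# + suc n · 1#)       ≈⟨ -‿+-comm _ _ ⟨
    - (suc m · 1#) - (suc n · 1#)     ∎

  ⟦⟧-*-pos : ∀ m j → ⟦ + m ℤ.* j ⟧ℤ ≈ m · 1# * ⟦ j ⟧ℤ
  ⟦⟧-*-pos m (+ n) = begin
    ⟦ + m ℤ.* + n ⟧ℤ     ≡⟨ ≡.cong ⟦_⟧ℤ (ℤ.pos-* m n) ⟨
    (m ℕ.* n) · 1#       ≈⟨ ×1-homo-* m n ⟩
    (m · 1#) * (n · 1#)  ∎
  ⟦⟧-*-pos m -[1+ n ] = begin
    ⟦ + m ℤ.* -[1+ n ] ⟧ℤ        ≡⟨ ≡.cong ⟦_⟧ℤ (ℤ.neg-distribʳ-* (+ m) (+ suc n)) ⟨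
    ⟦ ℤ.- (+ m ℤ.* + suc n) ⟧ℤ   ≈⟨ ⟦⟧-neg (+ m ℤ.* + suc n) ⟩
    - ⟦ + m ℤ.* + suc n ⟧ℤ       ≈⟨ -‿cong (⟦⟧-*-pos m (+ suc n)) ⟩
    - (m · 1# * (suc n · 1#))    ≈⟨ -‿distribʳ-* _ _ ⟩
    m · 1# * - (suc n · 1#)      ∎

  ⟦⟧-* : ∀ i j → ⟦ i ℤ.* j ⟧ℤ ≈ ⟦ i ⟧ℤ * ⟦ j ⟧ℤ
  ⟦⟧-* (+ m)    j = ⟦⟧-*-pos m j
  ⟦⟧-* -[1+ m ] j = begin
    ⟦ -[1+ m ] ℤ.* j ⟧ℤ          ≡⟨ ≡.cong ⟦_⟧ℤ (ℤ.neg-distribˡ-* (+ suc m) j) ⟨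
    ⟦ ℤ.- (+ suc m ℤ.* j) ⟧ℤ     ≈⟨ ⟦⟧-neg (+ suc m ℤ.* j) ⟩
    - ⟦ + suc m ℤ.* j ⟧ℤ         ≈⟨ -‿cong (⟦⟧-*-pos (suc m) j) ⟩
    - (suc m · 1# * ⟦ j ⟧ℤ)      ≈⟨ -‿distribˡ-* _ _ ⟩
    - (suc m · 1#) * ⟦ j ⟧ℤ      ∎

  morphism : ℤ.+-*-rawRing -Raw-AlmostCommutative⟶ fromCommutativeRing R
  morphism = record
    { ⟦_⟧ = ⟦_⟧ℤ ; +-homo = ⟦⟧-+ ; *-homo = ⟦⟧-* ; -‿homo = ⟦⟧-neg
    ; 0-homo = refl ; 1-homo = refl }

  open Algebra.Solver.Ring ℤ.+-*-rawRing (fromCommutativeRing R) morphism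
    (λ i j → Maybe.map (λ eq → reflexive (≡.cong ⟦_⟧ℤ eq)) (dec⇒weaklyDec ℤ._≟_ i j)) public
    using (solve; _:+_; _:*_; _:-_; :-_; _:=_; con)

-- Families of columns and alternating forms on them.

module LinearAlgebra (ℝ : RealNumbers) where
  open RealNumbers ℝ
  open GelfandTsetlin ℝ
  open CommutativeRing commutativeRing
    using (setoid; refl; sym; trans; +-cong; +-congˡ; +-congʳ; +-assoc; +-identityˡ; +-identityʳ; -‿cong;
           *-cong; *-congˡ; *-congʳ; *-assoc; *-identityˡ; zeroˡ; zeroʳ)
  open import Algebra.Properties.Semiring.Exp semiring using (_^_)
  open Algebra.Properties.Semiring.Sum semiring
    using (sum; sum-syntax; sum-cong-≋; ∑-distrib-+; *-distribˡ-sum; sum-replicate-zero)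
  open IntegerSolver commutativeRing
  open DecTotalOrder decTotalOrder using (_≟_)
  open Relation.Binary.Reasoning.Setoid setoid

  *-cancel-nonzero : ∀ {a b} → ¬ a ≈ 0# → a * b ≈ 0# → b ≈ 0#
  *-cancel-nonzero {a} {b} a≉0 ab≈0 with *-inverse a a≉0
  ... | c , ac≈1 = begin
    b            ≈⟨ *-identityˡ b ⟨
    1# * b       ≈⟨ *-congʳ ac≈1 ⟨
    a * c * b    ≈⟨ solve 3 (λ a b c → a :* c :* b := c :* (a :* b)) refl a b c ⟩
    c * (a * b)  ≈⟨ *-congˡ ab≈0 ⟩
    c * 0#       ≈⟨ zeroʳ c ⟩
    0#           ∎

  sum-zero : ∀ {s} (f : Vector Carrier s) → (∀ k → f k ≈ 0#) → sum f ≈ 0#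
  sum-zero {s} f f≈0 = trans (sum-cong-≋ f≈0) (sum-replicate-zero s)

  sum-lincomb : ∀ {s} a b (f g : Vector Carrier s) →
                ∑[ k < s ] (a * f k + b * g k) ≈ a * sum f + b * sum g
  sum-lincomb a b f g = begin
    sum (λ k → a * f k + b * g k)             ≈⟨ ∑-distrib-+ (λ k → a * f k) (λ k → b * g k) ⟩
    sum (λ k → a * f k) + sum (λ k → b * g k) ≈⟨ +-cong (*-distribˡ-sum a f) (*-distribˡ-sum b g) ⟨
    a * sum f + b * sum g                     ∎

  -- Matrices are stored transposed, so that column operations act on the first members of a family.
  -- All maximal minors are then functions of one and the same family.
  Columns : ℕ → ℕ → Set
  Columns m s = Fin s → Vector Carrier m

  infix 4 _≈ᶜ_
  _≈ᶜ_ : ∀ {m s} → Columns m s → Columns m s → Set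
  C ≈ᶜ C′ = ∀ k r → C k r ≈ C′ k r

  infixl 6 _⊞_∙_
  _⊞_∙_ : ∀ {m} → Vector Carrier m → Carrier → Vector Carrier m → Vector Carrier m
  (u ⊞ c ∙ w) r = u r + c * w r

  ∷-congʳ : ∀ {m s} (u : Vector Carrier m) {C C′ : Columns m s} → C ≈ᶜ C′ → u ∷ C ≈ᶜ u ∷ C′
  ∷-congʳ u eq zero    r = refl
  ∷-congʳ u eq (suc k) r = eq k r

  head∷tail : ∀ {m s} (C : Columns m (suc s)) → C ≈ᶜ head C ∷ tail C
  head∷tail C zero    r = refl
  head∷tail C (suc k) r = refl

  Congruent : ∀ {m s} → (Columns m s → Carrier) → Set
  Congruent F = ∀ {C C′} → C ≈ᶜ C′ → F C ≈ F C′

  -- Recursion on the number of columns, fixing them one at a time from the left, replaces any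
  -- indexing of the position in which linearity is used.
  Multilinear : ∀ {m s} → (Columns m s → Carrier) → Set
  Multilinear {s = zero}  F = ⊤
  Multilinear {s = suc s} F =
    (∀ u c w C → F ((u ⊞ c ∙ w) ∷ C) ≈ F (u ∷ C) + c * F (w ∷ C)) ×
    (∀ u → Multilinear (λ C → F (u ∷ C)))

  HeadAlternating : ∀ {m s} → (Columns m (suc s) → Carrier) → Set
  HeadAlternating {s = zero}  F = ⊤
  HeadAlternating {s = suc s} F = ∀ u C → F (u ∷ u ∷ C) ≈ 0#

  -- Only adjacent repetitions are required to give zero. That suffices here, as every column
  -- operation below combines two neighbouring columns.
  Alternating : ∀ {m s} → (Columns m s → Carrier) → Set
  Alternating {s = zero}  F = ⊤
  Alternating {s = suc s} F = HeadAlternating F × (∀ u → Alternating (λ C → F (u ∷ C)))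

  -- By `expand-∷`, a row expansion with its first column fixed is such a combination, with
  -- coefficients `u r` and `- 1#`. This lemma and `alternating-lincomb` thus carry the inductions
  -- on the number of columns.
  multilinear-lincomb : ∀ {m s} a b {F G H : Columns m s → Carrier} →
    (∀ C → F C ≈ a * G C + b * H C) → Multilinear G → Multilinear H → Multilinear F
  multilinear-lincomb {s = zero} a b eq _ _ = tt
  multilinear-lincomb {s = suc s} a b {F} {G} {H} eq (Gh , Gt) (Hh , Ht) =
    (λ u c w C → begin
      F ((u ⊞ c ∙ w) ∷ C)                            ≈⟨ eq _ ⟩
      a * G ((u ⊞ c ∙ w) ∷ C) + b * H ((u ⊞ c ∙ w) ∷ C)
        ≈⟨ +-cong (*-congˡ (Gh u c w C)) (*-congˡ (Hh u c w C)) ⟩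
      a * (G (u ∷ C) + c * G (w ∷ C)) + b * (H (u ∷ C) + c * H (w ∷ C))
        ≈⟨ solve 7 (λ a b c g g′ h h′ → a :* (g :+ c :* g′) :+ b :* (h :+ c :* h′) :=
                     a :* g :+ b :* h :+ c :* (a :* g′ :+ b :* h′)) refl a b c _ _ _ _ ⟩
      (a * G (u ∷ C) + b * H (u ∷ C)) + c * (a * G (w ∷ C) + b * H (w ∷ C))
        ≈⟨ +-cong (eq _) (*-congˡ (eq _)) ⟨
      F (u ∷ C) + c * F (w ∷ C)                      ∎) ,
    (λ u → multilinear-lincomb a b (λ C → eq (u ∷ C)) (Gt u) (Ht u))

  lincomb-zero : ∀ a b {f g h} → f ≈ a * g + b * h → g ≈ 0# → h ≈ 0# → f ≈ 0#
  lincomb-zero a b {f} {g} {h} eq g≈0 h≈0 = begin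
    f                ≈⟨ eq ⟩
    a * g + b * h    ≈⟨ +-cong (*-congˡ g≈0) (*-congˡ h≈0) ⟩
    a * 0# + b * 0#  ≈⟨ +-cong (zeroʳ a) (zeroʳ b) ⟩
    0# + 0#          ≈⟨ +-identityˡ 0# ⟩
    0#               ∎

  headAlternating-lincomb : ∀ {m s} a b {F G H : Columns m (suc s) → Carrier} →
    (∀ C → F C ≈ a * G C + b * H C) → HeadAlternating G → HeadAlternating H → HeadAlternating F
  headAlternating-lincomb {s = zero}  a b eq _  _  = tt
  headAlternating-lincomb {s = suc s} a b eq Gh Hh =
    λ u C → lincomb-zero a b (eq _) (Gh u C) (Hh u C)

  alternating-lincomb : ∀ {m s} a b {F G H : Columns m s → Carrier} →
    (∀ C → F C ≈ a * G C + b * H C) → Alternating G → Alternating H → Alternating F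
  alternating-lincomb {s = zero}  a b eq _ _ = tt
  alternating-lincomb {s = suc s} a b eq (Gh , Gt) (Hh , Ht) =
    headAlternating-lincomb a b eq Gh Hh ,
    (λ u → alternating-lincomb a b (λ C → eq (u ∷ C)) (Gt u) (Ht u))

  record IsAlternatingForm {m s} (F : Columns m s → Carrier) : Set where
    field
      congruent   : Congruent F
      multilinear : Multilinear F
      alternating : Alternating F

  open IsAlternatingForm

  fix-head : ∀ {m s} {F : Columns m (suc s) → Carrier} → IsAlternatingForm F →
             ∀ u → IsAlternatingForm (λ C → F (u ∷ C))
  fix-head F-form u = record
    { congruent   = λ eq → congruent F-form (∷-congʳ u eq)
    ; multilinear = proj₂ (multilinear F-form) u
    ; alternating = proj₂ (alternating F-form) u
    }

  -- Laplace expansion along a row.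

  term : ∀ {m s} → Fin m → (Columns m s → Carrier) → Columns m (suc s) → Vector Carrier (suc s)
  term r F C k = (- 1#) ^ toℕ k * (C k r * F (λ l → C (punchIn k l)))

  -- An arbitrary `F` stands in for the determinant of the minors, so that its properties can be
  -- transported through the expansion and every `det` is an iterate of this construction.
  expand : ∀ {m s} → Fin m → (Columns m s → Carrier) → Columns m (suc s) → Carrier
  expand r F C = sum (term r F C)

  term-cong : ∀ {m s} r {F G : Columns m s → Carrier} {C C′} k → C k r ≈ C′ k r →
              F (λ l → C (punchIn k l)) ≈ G (λ l → C′ (punchIn k l)) → term r F C k ≈ term r G C′ k
  term-cong r {F} {G} {C} {C′} k x≈y f≈g = *-congˡ {x = (- 1#) ^ toℕ k} (*-cong x≈y f≈g)

  term-zero : ∀ {m s} r {F : Columns m s → Carrier} {C} k →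
              F (λ l → C (punchIn k l)) ≈ 0# → term r F C k ≈ 0#
  term-zero r {C = C} k f≈0 =
    trans (*-congˡ {x = (- 1#) ^ toℕ k} (trans (*-congˡ f≈0) (zeroʳ (C k r)))) (zeroʳ _)

  expand-cong : ∀ {m s} r {F : Columns m s → Carrier} → Congruent F → Congruent (expand r F)
  expand-cong r {F} F-cong {C} {C′} eq =
    sum-cong-≋ (λ k → term-cong r {F} {F} {C} {C′} k (eq k r) (F-cong (λ l → eq (punchIn k l))))

  expand-lincomb : ∀ {m s} r a b {F G H : Columns m s → Carrier} →
    (∀ C → F C ≈ a * G C + b * H C) → ∀ C → expand r F C ≈ a * expand r G C + b * expand r H C
  expand-lincomb {s = s} r a b {F} {G} {H} eq C = trans
    (sum-cong-≋ (λ k → let σ = (- 1#) ^ toℕ k; C′ = λ l → C (punchIn k l) in begin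
      σ * (C k r * F C′)                   ≈⟨ *-congˡ {x = σ} (*-congˡ (eq C′)) ⟩
      σ * (C k r * (a * G C′ + b * H C′))
        ≈⟨ solve 6 (λ σ x a g b h → σ :* (x :* (a :* g :+ b :* h)) :=
                     a :* (σ :* (x :* g)) :+ b :* (σ :* (x :* h))) refl σ (C k r) a (G C′) b (H C′) ⟩
      a * (σ * (C k r * G C′)) + b * (σ * (C k r * H C′)) ∎))
    (sum-lincomb a b (term r G C) (term r H C))

  expand-[] : ∀ {m} r (F : Columns m 0 → Carrier) u C → expand r F (u ∷ C) ≈ u r * F C
  expand-[] r F u C = trans (+-identityʳ _) (*-identityˡ _)

  -- Splitting off the first column makes expansion along a row recursive in the columns, which is how
  -- multilinearity and alternation are obtained.
  expand-∷ : ∀ {m s} r {F : Columns m (suc s) → Carrier} → Congruent F → ∀ u C →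
             expand r F (u ∷ C) ≈ u r * F C + - 1# * expand r (λ C′ → F (u ∷ C′)) C
  expand-∷ r {F} F-cong u C = +-cong (*-identityˡ _) (begin
    sum (λ k → term r F (u ∷ C) (suc k))
      ≈⟨ sum-cong-≋ (λ k → trans (*-assoc (- 1#) _ _)
           (*-congˡ {x = - 1#} (*-congˡ {x = (- 1#) ^ toℕ k} (*-congˡ {x = C k r} (F-cong (punch k)))))) ⟩
    sum (λ k → - 1# * term r (λ C′ → F (u ∷ C′)) C k)
      ≈⟨ *-distribˡ-sum (- 1#) (term r (λ C′ → F (u ∷ C′)) C) ⟨
    - 1# * expand r (λ C′ → F (u ∷ C′)) C ∎)
    where
    punch : ∀ k → (λ l → (u ∷ C) (punchIn (suc k) l)) ≈ᶜ u ∷ (λ l → C (punchIn k l))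
    punch k zero    r = refl
    punch k (suc l) r = refl

  -- In the first column, both summands of `expand-∷` are linear: one through `u r`, the other
  -- through the first argument of `F`. In the later columns, the expansion is a combination of `F`
  -- and a smaller expansion.
  expand-multilinear : ∀ {m s} r {F : Columns m s → Carrier} → IsAlternatingForm F →
                       Multilinear (expand r F)
  expand-multilinear {s = zero} r {F} F-form =
    (λ u c w C → begin
      expand r F ((u ⊞ c ∙ w) ∷ C)      ≈⟨ expand-[] r F (u ⊞ c ∙ w) C ⟩
      (u r + c * w r) * F C
        ≈⟨ solve 4 (λ x c y f → (x :+ c :* y) :* f := x :* f :+ c :* (y :* f)) refl (u r) c (w r) (F C) ⟩
      u r * F C + c * (w r * F C)
        ≈⟨ +-cong (expand-[] r F u C) (*-congˡ (expand-[] r F w C)) ⟨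
      expand r F (u ∷ C) + c * expand r F (w ∷ C) ∎) ,
    (λ u → tt)
  expand-multilinear {s = suc s} r {F} F-form =
    (λ u c w C → begin
      expand r F ((u ⊞ c ∙ w) ∷ C)      ≈⟨ expand-∷ r F-cong (u ⊞ c ∙ w) C ⟩
      (u r + c * w r) * F C + - 1# * expand r (λ C′ → F ((u ⊞ c ∙ w) ∷ C′)) C
        -- The coefficient `1#` is inserted only to bring linearity of `F` into the two-coefficient
        -- shape.
        ≈⟨ +-congˡ (*-congˡ (expand-lincomb r 1# c
             (λ C′ → trans (proj₁ (multilinear F-form) u c w C′) (+-congʳ (sym (*-identityˡ _)))) C)) ⟩
      (u r + c * w r) * F C + - 1# * (1# * E u C + c * E w C)
        ≈⟨ solve 6 (λ x c y f d e → (x :+ c :* y) :* f :+ con (ℤ.- + 1) :* (con (+ 1) :* d :+ c :* e) :=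
             (x :* f :+ con (ℤ.- + 1) :* d) :+ c :* (y :* f :+ con (ℤ.- + 1) :* e)) refl
             (u r) c (w r) (F C) (E u C) (E w C) ⟩
      (u r * F C + - 1# * E u C) + c * (w r * F C + - 1# * E w C)
        ≈⟨ +-cong (expand-∷ r F-cong u C) (*-congˡ (expand-∷ r F-cong w C)) ⟨
      expand r F (u ∷ C) + c * expand r F (w ∷ C) ∎) ,
    (λ u → multilinear-lincomb (u r) (- 1#) (expand-∷ r F-cong u)
             (multilinear F-form) (expand-multilinear r (fix-head F-form u)))
    where
    F-cong : Congruent F
    F-cong = congruent F-form
    E : Vector Carrier _ → Columns _ _ → Carrier
    E u = expand r (λ C → F (u ∷ C))

  -- The first two terms of the expansion cancel, having the same minor and opposite signs; in all
  -- later terms `F` receives `u` twice in front and vanishes.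
  expand-headAlternating : ∀ {m s} r {F : Columns m s → Carrier} → IsAlternatingForm F →
                           HeadAlternating (expand r F)
  expand-headAlternating {s = zero}  r F-form = tt
  expand-headAlternating {s = suc s} r {F} F-form u C = begin
    expand r F (u ∷ u ∷ C)                        ≈⟨ expand-∷ r (congruent F-form) u (u ∷ C) ⟩
    u r * F (u ∷ C) + - 1# * expand r (λ C′ → F (u ∷ C′)) (u ∷ C)
                                                  ≈⟨ +-congˡ (*-congˡ (minor F F-form C)) ⟩
    u r * F (u ∷ C) + - 1# * (u r * F (u ∷ C))
      ≈⟨ solve 2 (λ x f → x :* f :+ con (ℤ.- + 1) :* (x :* f) := con (+ 0)) refl (u r) (F (u ∷ C)) ⟩
    0#                                            ∎
    where
    minor : ∀ {s} (F : Columns _ (suc s) → Carrier) → IsAlternatingForm F → ∀ C →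
            expand r (λ C′ → F (u ∷ C′)) (u ∷ C) ≈ u r * F (u ∷ C)
    minor {zero}  F F-form C = expand-[] r (λ C′ → F (u ∷ C′)) u C
    minor {suc s} F F-form C = begin
      expand r (λ C′ → F (u ∷ C′)) (u ∷ C)
        ≈⟨ expand-∷ r {λ C′ → F (u ∷ C′)} (congruent (fix-head F-form u)) u C ⟩
      u r * F (u ∷ C) + - 1# * expand r (λ C′ → F (u ∷ u ∷ C′)) C
        ≈⟨ +-congˡ (*-congˡ (sum-zero (term r (λ C′ → F (u ∷ u ∷ C′)) C)
             (λ k → term-zero r {λ C′ → F (u ∷ u ∷ C′)} {C} k (proj₁ (alternating F-form) u _)))) ⟩
      u r * F (u ∷ C) + - 1# * 0#   ≈⟨ trans (+-congˡ (zeroʳ _)) (+-identityʳ _) ⟩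
      u r * F (u ∷ C)               ∎

  expand-alternating : ∀ {m s} r {F : Columns m s → Carrier} → IsAlternatingForm F →
                       Alternating (expand r F)
  expand-alternating {s = zero}  r F-form = tt , (λ u → tt)
  expand-alternating {s = suc s} r F-form =
    expand-headAlternating r F-form ,
    (λ u → alternating-lincomb (u r) (- 1#) (expand-∷ r (congruent F-form) u)
             (alternating F-form) (expand-alternating r (fix-head F-form u)))

  expand-form : ∀ {m s} r {F : Columns m s → Carrier} → IsAlternatingForm F →
                IsAlternatingForm (expand r F)
  expand-form r F-form = record
    { congruent   = expand-cong r (congruent F-form)
    ; multilinear = expand-multilinear r F-form
    ; alternating = expand-alternating r F-form
    }

  -- By definition of `det`, the minor on the rows `ρ` is the expansion along row `ρ zero` of the
  -- minor on the rows `ρ ∘ suc`.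
  det-form : ∀ {m s} (ρ : Fin s → Fin m) → IsAlternatingForm (λ C → det (λ i k → C k (ρ i)))
  det-form {s = zero}  ρ = record { congruent = λ _ → refl ; multilinear = tt ; alternating = tt }
  det-form {s = suc s} ρ = expand-form (ρ zero) (det-form (ρ ∘ suc))

  -- Column operations and their effect on forms and kernels.

  combination : ∀ {m s} → Columns m s → Vector Carrier s → Vector Carrier m
  combination C v r = sum (λ k → C k r * v k)

  combination-cong : ∀ {m s} {C C′ : Columns m s} → C ≈ᶜ C′ → ∀ v r → combination C v r ≈ combination C′ v r
  combination-cong eq v r = sum-cong-≋ (λ k → *-congʳ (eq k r))

  -- Enough to transfer triviality of the kernel from C′ to C.
  Reparametrizes : ∀ {m s} → Columns m s → Columns m s → Set
  Reparametrizes {s = s} C C′ = (v : Vector Carrier s) → Σ[ w ∈ Vector Carrier s ]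
    (∀ r → combination C v r ≈ combination C′ w r) × ((∀ k → w k ≈ 0#) → ∀ k → v k ≈ 0#)

  reparametrizes-trans : ∀ {m s} {C C′ C″ : Columns m s} →
    Reparametrizes C C′ → Reparametrizes C′ C″ → Reparametrizes C C″
  reparametrizes-trans f g v with f v
  ... | w , eq , zero⇒ with g w
  ... | w′ , eq′ , zero⇒′ = w′ , (λ r → trans (eq r) (eq′ r)) , zero⇒ ∘ zero⇒′

  reparametrizes-∷ : ∀ {m s} u {C C′ : Columns m s} → Reparametrizes C C′ → Reparametrizes (u ∷ C) (u ∷ C′)
  reparametrizes-∷ u f v with f (tail v)
  ... | w , eq , zero⇒ =
    head v ∷ w , (λ r → +-congˡ (eq r)) ,
    λ { z zero → z zero ; z (suc k) → zero⇒ (z ∘ suc) k }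

  trivialKernel-transfer : ∀ {m s} (C C′ : Columns m s) → Reparametrizes C C′ →
    TrivialKernel (λ r k → C′ k r) → TrivialKernel (λ r k → C k r)
  trivialKernel-transfer C C′ f triv v Cv≈0 with f v
  ... | w , eq , zero⇒ = zero⇒ (triv w (λ r → trans (sym (eq r)) (Cv≈0 r)))

  -- Column equivalence is recorded by what it preserves rather than by a list of operations.
  -- Quantifying over all alternating forms covers all maximal minors at once.
  infix 4 _≃_
  record _≃_ {m s} (C C′ : Columns m s) : Set where
    field
      forms : ∀ {F} → IsAlternatingForm F → F C ≈ F C′
      to    : Reparametrizes C C′
      from  : Reparametrizes C′ C

  open _≃_

  ≈ᶜ⇒≃ : ∀ {m s} {C C′ : Columns m s} → C ≈ᶜ C′ → C ≃ C′
  ≈ᶜ⇒≃ eq = record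
    { forms = λ F-form → congruent F-form eq
    ; to    = λ v → v , combination-cong eq v , id
    ; from  = λ v → v , combination-cong (λ k r → sym (eq k r)) v , id
    }

  ≃-trans : ∀ {m s} {C C′ C″ : Columns m s} → C ≃ C′ → C′ ≃ C″ → C ≃ C″
  ≃-trans p q = record
    { forms = λ F-form → trans (forms p F-form) (forms q F-form)
    ; to    = reparametrizes-trans (to p) (to q)
    ; from  = reparametrizes-trans (from q) (from p)
    }

  ≃-∷ : ∀ {m s} u {C C′ : Columns m s} → C ≃ C′ → u ∷ C ≃ u ∷ C′
  ≃-∷ u p = record
    { forms = λ F-form → forms p (fix-head F-form u)
    ; to    = reparametrizes-∷ u (to p)
    ; from  = reparametrizes-∷ u (from p)
    }

  -- The change of coefficients is unitriangular: subtracting `d` times the second new coefficient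
  -- recovers the old first one, so zero new coefficients force zero old ones.
  reparametrize-first : ∀ {m s} {u w u′ w′ : Vector Carrier m} {C : Columns m s} d →
    (∀ r a b → u r * a + w r * b ≈ u′ r * (a + d * b) + w′ r * b) →
    Reparametrizes (u ∷ w ∷ C) (u′ ∷ w′ ∷ C)
  reparametrize-first {u = u} {w} {u′} {w′} {C} d eq v =
    (a + d * b) ∷ tail v ,
    (λ r → trans (sym (+-assoc _ _ _)) (trans (+-congʳ (eq r a b)) (+-assoc _ _ _))) ,
    λ { z zero → begin
          a                      ≈⟨ solve 3 (λ a b d → a := (a :+ d :* b) :- d :* b) refl a b d ⟩
          (a + d * b) - d * b    ≈⟨ +-cong (z zero) (-‿cong (*-congˡ (z (suc zero)))) ⟩
          0# - d * 0#            ≈⟨ solve 1 (λ d → con (+ 0) :- d :* con (+ 0) := con (+ 0)) refl d ⟩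
          0#                     ∎
      ; z (suc k) → z (suc k) }
    where
    a = v zero
    b = v (suc zero)

  reparametrize-second : ∀ {m s} {u w u′ w′ : Vector Carrier m} {C : Columns m s} d →
    (∀ r a b → u r * a + w r * b ≈ u′ r * a + w′ r * (b + d * a)) →
    Reparametrizes (u ∷ w ∷ C) (u′ ∷ w′ ∷ C)
  reparametrize-second {u = u} {w} {u′} {w′} {C} d eq v =
    a ∷ (b + d * a) ∷ tail (tail v) ,
    (λ r → trans (sym (+-assoc _ _ _)) (trans (+-congʳ (eq r a b)) (+-assoc _ _ _))) ,
    λ { z zero → z zero
      ; z (suc zero) → begin
          b                      ≈⟨ solve 3 (λ a b d → b := (b :+ d :* a) :- d :* a) refl a b d ⟩
          (b + d * a) - d * a    ≈⟨ +-cong (z (suc zero)) (-‿cong (*-congˡ (z zero))) ⟩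
          0# - d * 0#            ≈⟨ solve 1 (λ d → con (+ 0) :- d :* con (+ 0) := con (+ 0)) refl d ⟩
          0#                     ∎
      ; z (suc (suc k)) → z (suc (suc k)) }
    where
    a = v zero
    b = v (suc zero)

  repeated-column : ∀ {m s} {F : Columns m (suc (suc s)) → Carrier} → IsAlternatingForm F →
                    ∀ c u C → c * F (u ∷ u ∷ C) ≈ 0#
  repeated-column F-form c u C = trans (*-congˡ (proj₁ (alternating F-form) u C)) (zeroʳ c)

  -- For forms, linearity produces one extra term, in which `w` is repeated. For kernels, adding `c`
  -- times `w` to `u` is undone by subtracting `c` times the first coefficient from the second.
  shear-first : ∀ {m s} u w c (C : Columns m s) → u ∷ w ∷ C ≃ (u ⊞ c ∙ w) ∷ w ∷ C
  shear-first u w c C = record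
    { forms = λ F-form → sym (trans (proj₁ (multilinear F-form) u c w (w ∷ C))
        (trans (+-congˡ (repeated-column F-form c w C)) (+-identityʳ _)))
    ; to   = reparametrize-second (- c) (λ r a b → solve 5 (λ x y a b c →
        x :* a :+ y :* b := (x :+ c :* y) :* a :+ y :* (b :+ (:- c) :* a)) refl (u r) (w r) a b c)
    ; from = reparametrize-second c (λ r a b → solve 5 (λ x y a b c →
        (x :+ c :* y) :* a :+ y :* b := x :* a :+ y :* (b :+ c :* a)) refl (u r) (w r) a b c)
    }

  shear-second : ∀ {m s} u w c (C : Columns m s) → u ∷ w ∷ C ≃ u ∷ (w ⊞ c ∙ u) ∷ C
  shear-second u w c C = record
    { forms = λ F-form → sym (trans (proj₁ (multilinear (fix-head F-form u)) w c u C)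
        (trans (+-congˡ (repeated-column F-form c u C)) (+-identityʳ _)))
    ; to   = reparametrize-first (- c) (λ r a b → solve 5 (λ x y a b c →
        x :* a :+ y :* b := x :* (a :+ (:- c) :* b) :+ (y :+ c :* x) :* b) refl (u r) (w r) a b c)
    ; from = reparametrize-first c (λ r a b → solve 5 (λ x y a b c →
        x :* a :+ (y :+ c :* x) :* b := x :* (a :+ c :* b) :+ y :* b) refl (u r) (w r) a b c)
    }

  -- Adding e times w to u makes the entry of u in row r a pivot.
  eliminate : ∀ {m s} (r : Fin m) u w (C : Columns m s) →
    ∃[ u′ ] ∃[ w′ ] u ∷ w ∷ C ≃ u′ ∷ w′ ∷ C × w′ r ≈ 0#
  eliminate r u w C with w r ≟ 0#
  ... | yes wr≈0 = u , w , ≈ᶜ⇒≃ (λ k r → refl) , wr≈0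
  ... | no  wr≉0 with pivot
    where
    pivot : ∃[ e ] ¬ u r + e * w r ≈ 0#
    pivot with u r ≟ 0#
    ... | yes ur≈0 = 1# , λ eq → wr≉0 (begin
      w r              ≈⟨ trans (+-identityˡ _) (*-identityˡ _) ⟨
      0# + 1# * w r    ≈⟨ +-congʳ ur≈0 ⟨
      u r + 1# * w r   ≈⟨ eq ⟩
      0#               ∎)
    ... | no  ur≉0 = 0# , λ eq → ur≉0 (trans (sym (trans (+-congˡ (zeroˡ _)) (+-identityʳ _))) eq)
  ... | e , p≉0 with *-inverse (u r + e * w r) p≉0
  ... | q , pq≈1 =
    u ⊞ e ∙ w , w ⊞ c ∙ (u ⊞ e ∙ w) ,
    ≃-trans (shear-first u w e C) (shear-second (u ⊞ e ∙ w) w c C) , (begin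
      w r + - (w r * q) * p   ≈⟨ solve 3 (λ y p q → y :+ (:- (y :* q)) :* p := y :* (con (+ 1) :- p :* q)) refl (w r) p q ⟩
      w r * (1# - p * q)      ≈⟨ *-congˡ (+-congˡ (-‿cong pq≈1)) ⟩
      w r * (1# - 1#)         ≈⟨ solve 1 (λ y → y :* (con (+ 1) :- con (+ 1)) := con (+ 0)) refl (w r) ⟩
      0#                      ∎)
    where
    p = u r + e * w r
    c = - (w r * q)

  -- Row `r` is cleared from the right: the recursive call leaves at most one nonzero entry in the
  -- tail, at its head, and `eliminate` removes it without touching the columns behind.
  reduce : ∀ {m s} (r : Fin m) (C : Columns m (suc s)) →
           Σ[ C′ ∈ Columns m (suc s) ] C ≃ C′ × (∀ k → C′ (suc k) r ≈ 0#)
  reduce {s = zero}  r C = C , ≈ᶜ⇒≃ (λ k r → refl) , λ ()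
  reduce {s = suc s} r C with reduce r (tail C)
  ... | T , tail≃ , T≈0 with eliminate r (head C) (head T) (tail T)
  ... | u , w , ≃′ , wr≈0 =
    u ∷ w ∷ tail T ,
    ≃-trans (≈ᶜ⇒≃ (head∷tail C)) (≃-trans (≃-∷ (head C) tail≃)
      (≃-trans (≈ᶜ⇒≃ (∷-congʳ (head C) (head∷tail T))) ≃′)) ,
    λ { zero → wr≈0 ; (suc k) → T≈0 k }

  -- Nonsingular maximal submatrices and trivial kernels.

  expand-reduced : ∀ {m s} r (F : Columns m s → Carrier) (C : Columns m (suc s)) →
    (∀ k → C (suc k) r ≈ 0#) → expand r F C ≈ C zero r * F (tail C)
  expand-reduced r F C C≈0 = begin
    expand r F C
      ≈⟨ +-cong (*-identityˡ _) (sum-zero (λ k → term r F C (suc k)) (λ k →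
           trans (*-congˡ {x = (- 1#) ^ toℕ (suc k)} (trans (*-congʳ (C≈0 k)) (zeroˡ _))) (zeroʳ _))) ⟩
    C zero r * F (tail C) + 0#   ≈⟨ +-identityʳ _ ⟩
    C zero r * F (tail C)        ∎

  combination-reduced : ∀ {m s} r (C : Columns m (suc s)) → (∀ k → C (suc k) r ≈ 0#) →
    ∀ v → combination C v r ≈ C zero r * v zero
  combination-reduced r C C≈0 v =
    trans (+-congˡ (sum-zero (λ k → C (suc k) r * v (suc k)) (λ k → trans (*-congʳ (C≈0 k)) (zeroˡ _))))
          (+-identityʳ _)

  -- After reduction the determinant is the pivot times a smaller determinant, so neither factor
  -- vanishes. The first equation then kills `v zero`, and the others form a system for the minor.
  nonsingular⇒trivialKernel : ∀ {s} (M : Matrix s s) → ¬ det M ≈ 0# → TrivialKernel M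
  nonsingular⇒trivialKernel {zero}  M _ v _ ()
  nonsingular⇒trivialKernel {suc s} M det≉0 with reduce zero (λ k r → M r k)
  ... | C , M≃C , C≈0 = trivialKernel-transfer (λ k r → M r k) C (to M≃C) λ v Cv≈0 →
    let v₀≈0 = *-cancel-nonzero pivot≉0 (trans (sym (combination-reduced zero C C≈0 v)) (Cv≈0 zero))
    in λ { zero    → v₀≈0
         ; (suc k) → nonsingular⇒trivialKernel minor minor≉0 (tail v)
             (λ r → trans (sym (trans (+-congʳ (trans (*-congˡ v₀≈0) (zeroʳ _))) (+-identityˡ _)))
                          (Cv≈0 (suc r))) k }
    where
    minor : Matrix s s
    minor r k = C (suc k) (suc r)
    det≈ : det M ≈ C zero zero * det minor
    det≈ = trans (forms M≃C (det-form id))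
                 (expand-reduced zero (λ C′ → det (λ i k → C′ k (suc i))) C C≈0)
    pivot≉0 : ¬ C zero zero ≈ 0#
    pivot≉0 eq = det≉0 (trans det≈ (trans (*-congʳ eq) (zeroˡ _)))
    minor≉0 : ¬ det minor ≈ 0#
    minor≉0 eq = det≉0 (trans det≈ (trans (*-congˡ eq) (zeroʳ _)))

  nonsingularSubmatrix⇒trivialKernel : ∀ {m s} (M : Matrix m s) →
    HasNonsingularMaximalSubmatrix M → TrivialKernel M
  nonsingularSubmatrix⇒trivialKernel M (ρ , _ , det≉0) v Mv≈0 =
    nonsingular⇒trivialKernel (λ i → M (ρ i)) det≉0 v (Mv≈0 ∘ ρ)

  suc-monotone : ∀ {s m} {ρ : Fin s → Fin m} → ρ Preserves Fin._<_ ⟶ Fin._<_ →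
                 (suc ∘ ρ) Preserves Fin._<_ ⟶ Fin._<_
  suc-monotone ρ-mono i<j = s≤s (ρ-mono i<j)

  zero∷suc-monotone : ∀ {s m} {ρ : Fin s → Fin m} → ρ Preserves Fin._<_ ⟶ Fin._<_ →
                      (zero ∷ suc ∘ ρ) Preserves Fin._<_ ⟶ Fin._<_
  zero∷suc-monotone ρ-mono {zero}  {suc j} _         = s≤s z≤n
  zero∷suc-monotone ρ-mono {suc i} {suc j} (s≤s i<j) = s≤s (ρ-mono i<j)

  -- Induction on the rows, after clearing row zero. If its pivot is zero the whole row is zero,
  -- imposes no condition on the kernel and is skipped; otherwise it is selected, and the induction
  -- continues without the pivot row and column. `forms` carries the minor found back to `M`.
  trivialKernel⇒nonsingularSubmatrix : ∀ {m s} (M : Matrix m s) →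
    TrivialKernel M → HasNonsingularMaximalSubmatrix M
  trivialKernel⇒nonsingularSubmatrix {s = zero}  M _    = (λ ()) , (λ {}) , 0≉1 ∘ sym
  trivialKernel⇒nonsingularSubmatrix {zero}  {suc s} M triv =
    -- Without rows every vector lies in the kernel, in particular a nonzero constant one.
    contradiction (sym (triv (λ _ → 1#) (λ ()) zero)) 0≉1
  trivialKernel⇒nonsingularSubmatrix {suc m} {suc s} M triv with reduce zero (λ k r → M r k)
  ... | C , M≃C , C≈0 with C zero zero ≟ 0#
  ... | yes pivot≈0 = suc ∘ ρ , suc-monotone ρ-mono , λ eq → det≉0 (trans (sym (forms M≃C (det-form (suc ∘ ρ)))) eq)
    where
    lower : HasNonsingularMaximalSubmatrix (λ i k → C k (suc i))
    lower = trivialKernel⇒nonsingularSubmatrix {m} {suc s} (λ i k → C k (suc i)) λ v Cv≈0 →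
      trivialKernel-transfer C (λ k r → M r k) (from M≃C) triv v λ
        { zero    → trans (combination-reduced zero C C≈0 v) (trans (*-congʳ pivot≈0) (zeroˡ _))
        ; (suc r) → Cv≈0 r }
    ρ = proj₁ lower
    ρ-mono = proj₁ (proj₂ lower)
    det≉0 = proj₂ (proj₂ lower)
  ... | no pivot≉0 = zero ∷ suc ∘ ρ , zero∷suc-monotone ρ-mono , λ eq →
      det≉0 (*-cancel-nonzero pivot≉0 (trans (sym det≈) eq))
    where
    lower : HasNonsingularMaximalSubmatrix (λ i k → C (suc k) (suc i))
    lower = trivialKernel⇒nonsingularSubmatrix {m} {s} (λ i k → C (suc k) (suc i)) λ v Cv≈0 k →
      -- A kernel vector of the minor extends by `0#` in the pivot column, because row zero of `C`
      -- has no other nonzero entry than the pivot.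
      trivialKernel-transfer C (λ k r → M r k) (from M≃C) triv (0# ∷ v) (λ
        { zero    → trans (combination-reduced zero C C≈0 (0# ∷ v)) (zeroʳ _)
        ; (suc r) → trans (+-cong (zeroʳ _) (Cv≈0 r)) (+-identityˡ _) }) (suc k)
    ρ = proj₁ lower
    ρ-mono = proj₁ (proj₂ lower)
    det≉0 = proj₂ (proj₂ lower)
    det≈ : det (λ i k → M ((zero ∷ suc ∘ ρ) i) k) ≈ C zero zero * det (λ i k → C (suc k) (suc (ρ i)))
    det≈ = trans (forms M≃C (det-form (zero ∷ suc ∘ ρ)))
                 (expand-reduced zero (λ C′ → det (λ i k → C′ k (suc (ρ i)))) C C≈0)

-- Inequalities in an ordered field and sufficiently small positive numbers.

module OrderedField (ℝ : RealNumbers) where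
  open RealNumbers ℝ
  open CommutativeRing commutativeRing
    using (refl; sym; trans; +-cong; +-congˡ; +-comm; +-identityʳ; -‿cong; -‿inverseʳ;
           *-congˡ; *-comm; *-identityʳ; zeroʳ)
  open LinearAlgebra ℝ using (*-cancel-nonzero)
  open IntegerSolver commutativeRing
  module ≤ = DecTotalOrder decTotalOrder
  open import Relation.Binary.Reasoning.PartialOrder ≤.poset

  +-monoˡ-≤ : ∀ c {a b} → a ≤ b → a + c ≤ b + c
  +-monoˡ-≤ c {a} {b} a≤b = begin
    a + c  ≈⟨ +-comm a c ⟩
    c + a  ≤⟨ +-monoʳ-≤ c a≤b ⟩
    c + b  ≈⟨ +-comm c b ⟩
    b + c  ∎

  ≤⇒0≤- : ∀ {a b} → a ≤ b → 0# ≤ b - a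
  ≤⇒0≤- {a} {b} a≤b = begin
    0#     ≈⟨ -‿inverseʳ a ⟨
    a - a  ≤⟨ +-monoˡ-≤ (- a) a≤b ⟩
    b - a  ∎

  0≤-⇒≤ : ∀ {a b} → 0# ≤ b - a → a ≤ b
  0≤-⇒≤ {a} {b} 0≤b-a = begin
    a            ≈⟨ +-identityʳ a ⟨
    a + 0#       ≤⟨ +-monoʳ-≤ a 0≤b-a ⟩
    a + (b - a)  ≈⟨ solve 2 (λ a b → a :+ (b :- a) := b) refl a b ⟩
    b            ∎

  -≈0⇒≈ : ∀ {a b} → b - a ≈ 0# → a ≈ b
  -≈0⇒≈ {a} {b} b-a≈0 = begin-equality
    a            ≈⟨ +-identityʳ a ⟨
    a + 0#       ≈⟨ +-congˡ b-a≈0 ⟨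
    a + (b - a)  ≈⟨ solve 2 (λ a b → a :+ (b :- a) := b) refl a b ⟩
    b            ∎

  *-monoˡ-≤ : ∀ {a b c} → 0# ≤ c → a ≤ b → c * a ≤ c * b
  *-monoˡ-≤ {a} {b} {c} 0≤c a≤b = 0≤-⇒≤ (begin
    0#             ≤⟨ *-nonNeg 0≤c (≤⇒0≤- a≤b) ⟩
    c * (b - a)    ≈⟨ solve 3 (λ a b c → c :* (b :- a) := c :* b :- c :* a) refl a b c ⟩
    c * b - c * a  ∎)

  -- If `1#` were at most `0#`, then its negative would be nonnegative, and the square of that is
  -- `1#`.
  0≤1 : 0# ≤ 1#
  0≤1 with ≤.total 0# 1#
  ... | inj₁ 0≤1 = 0≤1
  ... | inj₂ 1≤0 = begin
    0#                     ≤⟨ *-nonNeg 0≤-1 0≤-1 ⟩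
    (0# - 1#) * (0# - 1#)  ≈⟨ solve 0 ((con (+ 0) :- con (+ 1)) :* (con (+ 0) :- con (+ 1)) := con (+ 1)) refl ⟩
    1#                     ∎
    where 0≤-1 = ≤⇒0≤- 1≤0

  0<1 : 0# < 1#
  0<1 = 0≤1 , 0≉1

  pos⇒≉0 : ∀ {a} → 0# < a → ¬ a ≈ 0#
  pos⇒≉0 (_ , 0≉a) a≈0 = 0≉a (sym a≈0)

  *-pos : ∀ {a b} → 0# < a → 0# < b → 0# < a * b
  *-pos 0<a 0<b = *-nonNeg (proj₁ 0<a) (proj₁ 0<b) ,
    λ 0≈ab → pos⇒≉0 0<b (*-cancel-nonzero (pos⇒≉0 0<a) (sym 0≈ab))

  inverse-pos : ∀ {a b} → 0# < a → a * b ≈ 1# → 0# < b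
  inverse-pos {a} {b} 0<a ab≈1 = 0≤b , λ 0≈b → 0≉1 (begin-equality
    0#      ≈⟨ zeroʳ a ⟨
    a * 0#  ≈⟨ *-congˡ 0≈b ⟩
    a * b   ≈⟨ ab≈1 ⟩
    1#      ∎)
    where
    0≤b : 0# ≤ b
    0≤b with ≤.total 0# b
    ... | inj₁ 0≤b = 0≤b
    ... | inj₂ b≤0 = contradiction (≤.antisym 0≤1 (begin
      1#      ≈⟨ ab≈1 ⟨
      a * b   ≤⟨ *-monoˡ-≤ (proj₁ 0<a) b≤0 ⟩
      a * 0#  ≈⟨ zeroʳ a ⟩
      0#      ∎)) 0≉1

  half : ∃[ h ] 0# < h × h < 1# × h + h ≈ 1#
  half = h , 0<h , (h≤1 , h≉1) , h+h≈1
    where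
    0<2 : 0# < 1# + 1#
    0<2 = 0≤2 , λ 0≈2 → 0≉1 (≤.antisym 0≤1 (begin
      1#       ≤⟨ 1≤2 ⟩
      1# + 1#  ≈⟨ 0≈2 ⟨
      0#       ∎))
      where
      1≤2 : 1# ≤ 1# + 1#
      1≤2 = begin
        1#       ≈⟨ +-identityʳ 1# ⟨
        1# + 0#  ≤⟨ +-monoʳ-≤ 1# 0≤1 ⟩
        1# + 1#  ∎
      0≤2 = ≤.trans 0≤1 1≤2
    inv = *-inverse (1# + 1#) (pos⇒≉0 0<2)
    h = proj₁ inv
    0<h : 0# < h
    0<h = inverse-pos 0<2 (proj₂ inv)
    h+h≈1 : h + h ≈ 1#
    h+h≈1 = begin-equality
      h + h          ≈⟨ solve 1 (λ h → h :+ h := (con (+ 1) :+ con (+ 1)) :* h) refl h ⟩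
      (1# + 1#) * h  ≈⟨ proj₂ inv ⟩
      1#             ∎
    h≤1 : h ≤ 1#
    h≤1 = begin
      h       ≈⟨ +-identityʳ h ⟨
      h + 0#  ≤⟨ +-monoʳ-≤ h (proj₁ 0<h) ⟩
      h + h   ≈⟨ h+h≈1 ⟩
      1#      ∎
    h≉1 : ¬ h ≈ 1#
    h≉1 h≈1 = pos⇒≉0 0<h (begin-equality
      h          ≈⟨ solve 1 (λ h → h := (h :+ h) :- h) refl h ⟩
      h + h - h  ≈⟨ +-cong h+h≈1 (-‿cong h≈1) ⟩
      1# - 1#    ≈⟨ -‿inverseʳ 1# ⟩
      0#         ∎)

  -- The nonnegative terms `s * (b - a)` and `t * (d - c)` add up to zero, so each is zero. This
  -- makes an inequality that is tight at a convex combination tight at its first point.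
  combination-rigidˡ : ∀ {s t a b c d} → 0# < s → 0# < t → a ≤ b → c ≤ d →
                       s * a + t * c ≈ s * b + t * d → a ≈ b
  combination-rigidˡ {s} {t} {a} {b} {c} {d} 0<s 0<t a≤b c≤d eq =
    -≈0⇒≈ (*-cancel-nonzero (pos⇒≉0 0<s) (≤.antisym gap≤0 (*-nonNeg (proj₁ 0<s) (≤⇒0≤- a≤b))))
    where
    gap≤0 : s * (b - a) ≤ 0#
    gap≤0 = begin
      s * (b - a)                        ≈⟨ +-identityʳ _ ⟨
      s * (b - a) + 0#                   ≤⟨ +-monoʳ-≤ _ (*-nonNeg (proj₁ 0<t) (≤⇒0≤- c≤d)) ⟩
      s * (b - a) + t * (d - c)          ≈⟨ solve 6 (λ s t a b c d → s :* (b :- a) :+ t :* (d :- c) :=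
                                              (s :* b :+ t :* d) :- (s :* a :+ t :* c)) refl s t a b c d ⟩
      (s * b + t * d) - (s * a + t * c)  ≈⟨ +-congˡ (-‿cong eq) ⟩
      (s * b + t * d) - (s * b + t * d)  ≈⟨ -‿inverseʳ _ ⟩
      0#                                 ∎

  -- Closure under finite conjunction yields one ε good for all the inequalities of the polytope,
  -- with no explicit minimum of bounds.
  Eventually : (Carrier → Set) → Set
  Eventually P = ∃[ δ ] 0# < δ × (∀ {ε} → 0# < ε → ε ≤ δ → P ε)

  eventually-witness : ∀ {P} → Eventually P → ∃[ ε ] 0# < ε × P ε
  eventually-witness (δ , 0<δ , small) = δ , 0<δ , small 0<δ ≤.refl

  eventually-map : ∀ {P Q : Carrier → Set} → (∀ {ε} → P ε → Q ε) → Eventually P → Eventually Q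
  eventually-map f (δ , 0<δ , small) = δ , 0<δ , λ 0<ε ε≤δ → f (small 0<ε ε≤δ)

  eventually-always : ∀ {P : Carrier → Set} → (∀ ε → P ε) → Eventually P
  eventually-always p = 1# , 0<1 , λ {ε} _ _ → p ε

  eventually-× : ∀ {P Q} → Eventually P → Eventually Q → Eventually (λ ε → P ε × Q ε)
  eventually-× (δ , 0<δ , p) (η , 0<η , q) with ≤.total δ η
  ... | inj₁ δ≤η = δ , 0<δ , λ 0<ε ε≤δ → p 0<ε ε≤δ , q 0<ε (≤.trans ε≤δ δ≤η)
  ... | inj₂ η≤δ = η , 0<η , λ 0<ε ε≤η → p 0<ε (≤.trans ε≤η η≤δ) , q 0<ε ε≤η

  eventually-∀Fin : ∀ {m} {P : Fin m → Carrier → Set} →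
                    (∀ i → Eventually (P i)) → Eventually (λ ε → ∀ i → P i ε)
  eventually-∀Fin {zero}  e = eventually-always (λ ε ())
  eventually-∀Fin {suc m} e =
    eventually-map (λ { (p , ps) zero → p ; (p , ps) (suc i) → ps i })
      (eventually-× (e zero) (eventually-∀Fin (e ∘ suc)))

  eventually-≤ : ∀ c {g} → 0# < g → Eventually (λ ε → ε * c ≤ g)
  eventually-≤ c {g} 0<g with c ≤.≤? 0#
  ... | yes c≤0 = 1# , 0<1 , λ {ε} 0<ε _ → begin
    ε * c   ≤⟨ *-monoˡ-≤ (proj₁ 0<ε) c≤0 ⟩
    ε * 0#  ≈⟨ zeroʳ ε ⟩
    0#      ≤⟨ proj₁ 0<g ⟩
    g       ∎
  -- The bound is the quotient of `g` by `c`, as `b` is the inverse of `c`.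
  ... | no c≰0 = g * b , *-pos 0<g (inverse-pos 0<c cb≈1) , λ {ε} 0<ε ε≤gb → begin
    ε * c        ≈⟨ *-comm ε c ⟩
    c * ε        ≤⟨ *-monoˡ-≤ (proj₁ 0<c) ε≤gb ⟩
    c * (g * b)  ≈⟨ solve 3 (λ c g b → c :* (g :* b) := g :* (c :* b)) refl c g b ⟩
    g * (c * b)  ≈⟨ *-congˡ cb≈1 ⟩
    g * 1#       ≈⟨ *-identityʳ g ⟩
    g            ∎
    where
    0<c : 0# < c
    0<c with ≤.total 0# c
    ... | inj₁ 0≤c = 0≤c , λ 0≈c → c≰0 (≤.reflexive (sym 0≈c))
    ... | inj₂ c≤0 = contradiction c≤0 c≰0
    inv = *-inverse c (pos⇒≉0 0<c)
    b = proj₁ inv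
    cb≈1 = proj₂ inv

-- Indices of a triangular array.

entry-elim : ∀ {n} {P : Index n → Set} → (∀ {j} .(j≤n : j ℕ.≤ n) i → P (entry j≤n i)) → ∀ p → P p
entry-elim f (index zero    j 1≤0 _ _) = contradiction-irr 1≤0 λ ()
entry-elim {P = P} f (index (suc i) j _ i<j j≤n) =
  -- The type of the bound depends on the position, so the motive abstracts over both; `recompute`
  -- supplies the bound from its irrelevant copy.
  ≡.subst (λ k → (k<j : k ℕ.< j) → P (index (suc k) j (s≤s z≤n) k<j j≤n)) (toℕ-fromℕ< i<j)
    (λ _ → f j≤n (fromℕ< i<j)) (recompute (_ ℕ.<? _) i<j)

adjacent-sym : ∀ {n} {p q : Index n} → Adjacent p q → Adjacent q p
adjacent-sym (inj₁ p↗q)               = inj₂ (inj₂ (inj₁ p↗q))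
adjacent-sym (inj₂ (inj₁ p↖q))        = inj₂ (inj₂ (inj₂ p↖q))
adjacent-sym (inj₂ (inj₂ (inj₁ q↗p))) = inj₁ q↗p
adjacent-sym (inj₂ (inj₂ (inj₂ q↖p))) = inj₂ (inj₁ q↖p)

-- Indicator sums and directions at a pattern.

module Vertices (ℝ : RealNumbers) where
  open RealNumbers ℝ
  open GelfandTsetlin ℝ
  open CommutativeRing commutativeRing
    using (setoid; refl; sym; trans; +-cong; +-congˡ; +-congʳ; +-identityˡ; +-identityʳ; -‿cong; -‿inverseʳ;
           *-congˡ; *-congʳ; *-identityˡ; zeroˡ; zeroʳ)
  open Algebra.Properties.Semiring.Sum semiring
    using (sum; sum-syntax; sum-cong-≋; ∑-comm; *-distribˡ-sum; *-distribʳ-sum; sum-remove)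
  open IntegerSolver commutativeRing
  open LinearAlgebra ℝ using (*-cancel-nonzero; sum-zero; sum-lincomb)
  open OrderedField ℝ
  open Relation.Binary.Reasoning.Setoid setoid

  sum-single : ∀ {s} (f : Vector Carrier s) k → (∀ l → ¬ l ≡ k → f l ≈ 0#) → sum f ≈ f k
  sum-single {suc s} f k f≈0 = begin
    sum f                              ≈⟨ sum-remove {i = k} f ⟩
    f k + sum (λ l → f (punchIn k l))  ≈⟨ +-congˡ (sum-zero _ (λ l → f≈0 _ (punchInᵢ≢i k l))) ⟩
    f k + 0#                           ≈⟨ +-identityʳ _ ⟩
    f k                                ∎

  indicator : {A : Set} → Dec A → Carrier
  indicator A? = if does A? then 1# else 0#

  indicator-true : ∀ {A} (A? : Dec A) → A → indicator A? ≈ 1#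
  indicator-true (yes _) a = refl
  indicator-true (no ¬a) a = contradiction a ¬a

  indicator-false : ∀ {A} (A? : Dec A) → ¬ A → indicator A? ≈ 0#
  indicator-false (yes a) ¬a = contradiction a ¬a
  indicator-false (no _)  ¬a = refl

  indicator-cong : ∀ {A B} (A? : Dec A) (B? : Dec B) → (A → B) → (B → A) → indicator A? ≈ indicator B?
  indicator-cong A? (yes b) f g = indicator-true A? (g b)
  indicator-cong A? (no ¬b) f g = indicator-false A? (¬b ∘ f)

  -- Needed for `allFin`, that is `tabulate id`, but its tail is of that form only for a general
  -- `f`.
  count-sum : ∀ {m} {A : Set} {P : Pred A 0ℓ} (P? : Decidable P) (f : Fin m → A) →
              fromℕ (count P? (tabulate f)) ≈ ∑[ i < m ] indicator (P? (f i))
  count-sum {zero}  P? f = refl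
  count-sum {suc m} P? f with does (P? (f zero))
  ... | true  = +-congˡ (count-sum P? (f ∘ suc))
  ... | false = trans (count-sum P? (f ∘ suc)) (sym (+-identityˡ _))

  eventually-∀Index : ∀ {n} {P : Index n → Carrier → Set} →
                      (∀ p → Eventually (P p)) → Eventually (λ ε → ∀ p → P p ε)
  eventually-∀Index {n} {P} e = eventually-map
    (λ {ε} h → entry-elim λ j≤n i → at j≤n (fromℕ< (s≤s j≤n)) (toℕ-fromℕ< (s≤s j≤n)) (h _) i)
    -- The row number runs from 0 to `n`, row 0 being empty.
    (eventually-∀Fin {suc n} λ j → eventually-∀Fin λ i → e (entry (toℕ≤pred[n] j) i))
    where
    -- With `j` a variable, matching on the equation replaces it by `toℕ k` and avoids a transport
    -- along rows.
    at : ∀ {ε j} .(j≤n : j ℕ.≤ n) (k : Fin (suc n)) → toℕ k ≡ j →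
         (∀ i → P (entry (toℕ≤pred[n] k) i) ε) → ∀ i → P (entry j≤n i) ε
    at j≤n k ≡.refl h = h

  -- These turn out to be exactly the d for which x ± ε d stays in GT(λ, μ) for small ε.
  record IsDirection {n} (x d : X n) : Set where
    field
      constant : ∀ {p q} → x q ≈ x p → Adjacent p q → d q ≈ d p
      top-zero : ∀ p → row p ≡ n → d p ≈ 0#
      rows-zero : ∀ j .(j≤n : j ℕ.≤ n) → rowSum d j j≤n ≈ 0#

    constant-on-tiles : ∀ {p q} → SameTile x p q → d p ≈ d q
    constant-on-tiles nil                = refl
    constant-on-tiles ((eq , adj) ◅ p~q) = trans (sym (constant eq adj)) (constant-on-tiles p~q)

    -- The bottom row has a single entry, which therefore equals its row sum.
    bottom-zero : ∀ p → pos p ≡ 1 × row p ≡ 1 → d p ≈ 0#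
    bottom-zero (index .1 .1 _ _ 1≤n) (≡.refl , ≡.refl) = trans (sym (+-identityʳ _)) (rows-zero 1 1≤n)

  -- Free tiles and the directions carried by them.

  module Tiling {n s} {x : X n} (𝒫 : FreeTiles x s) where
    open FreeTiles 𝒫

    sameTile-sym : ∀ {p q} → SameTile x p q → SameTile x q p
    sameTile-sym = reverse λ {p} {q} (eq , adj) → sym eq , adjacent-sym {p = p} {q} adj

    tile-closed : ∀ {p q} k → SameTile x p q → p ∈ tile k → q ∈ tile k
    tile-closed k p~q p∈ with isTile k
    ... | a , to , from = from (to p∈ ◅◅ p~q)

    tile-connected : ∀ {p q} k → p ∈ tile k → q ∈ tile k → SameTile x p q
    tile-connected k p∈ q∈ with isTile k
    ... | a , to , from = sameTile-sym (to p∈) ◅◅ to q∈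

    tile-unique : ∀ {p} k l → p ∈ tile k → p ∈ tile l → k ≡ l
    tile-unique k l p∈k p∈l = distinct
      ((λ q∈k → tile-closed l (tile-connected k p∈k q∈k) p∈l) ,
       (λ q∈l → tile-closed k (tile-connected l p∈l q∈l) p∈k))

    representative : Fin s → Index n
    representative k = proj₁ (isTile k)

    representative∈ : ∀ k → representative k ∈ tile k
    representative∈ k = proj₂ (proj₂ (isTile k)) nil

    spread : Vector Carrier s → X n
    spread v p = ∑[ k < s ] (indicator (tile? k p) * v k)

    spread-∈ : ∀ v {p} k → p ∈ tile k → spread v p ≈ v k
    spread-∈ v {p} k p∈k = begin
      spread v p                 ≈⟨ sum-single _ k (λ l l≢k → trans (*-congʳ (indicator-false (tile? l p)
                                      (λ p∈l → l≢k (tile-unique l k p∈l p∈k)))) (zeroˡ _)) ⟩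
      indicator (tile? k p) * v k ≈⟨ *-congʳ (indicator-true (tile? k p) p∈k) ⟩
      1# * v k                   ≈⟨ *-identityˡ _ ⟩
      v k                        ∎

    spread-∉ : ∀ v {p} → (∀ k → ¬ p ∈ tile k) → spread v p ≈ 0#
    spread-∉ v {p} p∉ = sum-zero _ (λ k → trans (*-congʳ (indicator-false (tile? k p) (p∉ k))) (zeroˡ _))

    -- Interchanging the two sums collects, for each tile, its indicators along the row, and these
    -- add up to the matrix entry.
    rowSum-spread : ∀ v r → rowSum (spread v) (2 ℕ.+ toℕ r) (tilingRow≤n r) ≈ ∑[ k < s ] (tilingMatrix 𝒫 r k * v k)
    rowSum-spread v r = begin
      (∑[ i < j ] ∑[ k < s ] (χ k i * v k))    ≈⟨ ∑-comm (λ i k → χ k i * v k) ⟩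
      (∑[ k < s ] ∑[ i < j ] (χ k i * v k))    ≈⟨ sum-cong-≋ (λ k → trans (*-congʳ (count-sum (λ i → tile? k (e i)) id))
                                                   (*-distribʳ-sum (v k) (χ k))) ⟨
      (∑[ k < s ] (tilingMatrix 𝒫 r k * v k))  ∎
      where
      j = 2 ℕ.+ toℕ r
      e : Fin j → Index n
      e = entry (tilingRow≤n r)
      χ : Fin s → Fin j → Carrier
      χ k i = indicator (tile? k (e i))

    -- If `d p` were nonzero, constancy would keep the tile of `p` away from the bottom entry and
    -- the top row, so it would be free and listed. Arguing by contradiction spares a search through
    -- the tile.
    not-free⇒zero : ∀ {d} → IsDirection x d → ∀ {p} → (∀ k → ¬ p ∈ tile k) → d p ≈ 0#
    not-free⇒zero {d} D {p} p∉ = decidable-stable (d p ≤.≟ 0#) λ dp≉0 →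
      let k , to , _ = complete {SameTile x p} (p , id , id) λ p~q →
            (λ bottom → dp≉0 (trans (constant-on-tiles p~q) (bottom-zero _ bottom))) ,
            (λ top → dp≉0 (trans (constant-on-tiles p~q) (top-zero _ top)))
      in p∉ k (to nil)
      where open IsDirection D

    direction≈spread : ∀ {d} → IsDirection x d → d ≋ spread (d ∘ representative)
    direction≈spread {d} D p with any? (λ k → tile? k p)
    ... | yes (k , p∈k) = trans (IsDirection.constant-on-tiles D (tile-connected k p∈k (representative∈ k)))
                                (sym (spread-∈ (d ∘ representative) k p∈k))
    ... | no  p∉ = trans (not-free⇒zero D p∉′) (sym (spread-∉ (d ∘ representative) p∉′))
      where
      p∉′ : ∀ k → ¬ p ∈ tile k
      p∉′ k p∈k = p∉ (k , p∈k)

    rowSum-cong : ∀ {y z : X n} → y ≋ z → ∀ j .(j≤n : j ℕ.≤ n) → rowSum y j j≤n ≈ rowSum z j j≤n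
    rowSum-cong eq j j≤n = sum-cong-≋ (λ i → eq (entry j≤n i))

    trivialKernel⇒direction-zero : TrivialKernel (tilingMatrix 𝒫) → ∀ {d} → IsDirection x d → ∀ p → d p ≈ 0#
    trivialKernel⇒direction-zero triv {d} D p = trans (direction≈spread D p)
      (sum-zero _ (λ k → trans (*-congˡ (v≈0 k)) (zeroʳ _)))
      where
      v : Vector Carrier s
      v = d ∘ representative
      v≈0 : ∀ k → v k ≈ 0#
      v≈0 = triv v λ r → begin
        ∑[ k < s ] (tilingMatrix 𝒫 r k * v k)                ≈⟨ rowSum-spread v r ⟨
        rowSum (spread v) (2 ℕ.+ toℕ r) (tilingRow≤n r)      ≈⟨ rowSum-cong (direction≈spread D) _ (tilingRow≤n r) ⟨
        rowSum d (2 ℕ.+ toℕ r) (tilingRow≤n r)               ≈⟨ IsDirection.rows-zero D _ (tilingRow≤n r) ⟩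
        0#                                                   ∎

    spread-direction : ∀ v → (∀ r → ∑[ k < s ] (tilingMatrix 𝒫 r k * v k) ≈ 0#) → IsDirection x (spread v)
    spread-direction v Av≈0 = record
      { constant  = λ {p} {q} eq adj → sum-cong-≋ λ k → *-congʳ (indicator-cong (tile? k q) (tile? k p)
                      (tile-closed k ((sym eq , adjacent-sym {p = p} {q} adj) ◅ nil)) (tile-closed k ((eq , adj) ◅ nil)))
      ; top-zero  = top-zero
      ; rows-zero = rows-zero
      }
      where
      top-zero : ∀ p → row p ≡ n → spread v p ≈ 0#
      top-zero p top = spread-∉ v λ k p∈k → proj₂ (isFree k p∈k) top

      rows-zero : ∀ j .(j≤n : j ℕ.≤ n) → rowSum (spread v) j j≤n ≈ 0#
      -- Row 0 is empty, and rows 1 and `n` meet no free tile; every other row is a row of the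
      -- tiling matrix, with its number shifted by 2.
      rows-zero 0 _ = refl
      rows-zero 1 1≤n = trans (+-identityʳ _) (spread-∉ v λ k p∈k → proj₁ (isFree k p∈k) (≡.refl , ≡.refl))
      rows-zero (suc (suc j)) j≤n with ℕ.m≤n⇒m<n∨m≡n (recompute (_ ℕ.≤? _) j≤n)
      ... | inj₂ j≡n = sum-zero _ (λ i → top-zero (entry j≤n i) j≡n)
      ... | inj₁ j<n = inner (fromℕ< j<n-2) (toℕ-fromℕ< j<n-2)
        where
        j<n-2 : j ℕ.< n ∸ 2
        j<n-2 = ℕ.∸-monoˡ-≤ 2 j<n
        inner : (r : Fin (n ∸ 2)) → toℕ r ≡ j → rowSum (spread v) (suc (suc j)) j≤n ≈ 0#
        inner r ≡.refl = trans (rowSum-spread v r) (Av≈0 r)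

  -- Moving along directions inside the polytope.

  infixl 6 _⊕_∙_
  _⊕_∙_ : ∀ {n} → X n → Carrier → X n → X n
  (x ⊕ c ∙ d) p = x p + c * d p

  negate-direction : ∀ {n} {x d : X n} → IsDirection x d → IsDirection x (λ p → - 1# * d p)
  negate-direction {d = d} D = record
    { constant  = λ eq adj → *-congˡ (constant eq adj)
    ; top-zero  = λ p top → trans (*-congˡ (top-zero p top)) (zeroʳ _)
    ; rows-zero = λ j j≤n → trans (sym (*-distribˡ-sum (- 1#) (λ i → d (entry j≤n i))))
                                  (trans (*-congˡ (rows-zero j j≤n)) (zeroʳ _))
    }
    where open IsDirection D

  module Polytope {n} {Λ μ : Vector ℤ n} where

    -- Repeated steps along `↗` lead from any entry to a smaller or equal one in the top row. After
    -- a perturbation only the top row needs checking, and there a direction vanishes.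
    lower⇒nonNeg : ∀ {y : X n} → (∀ {p q} → p ↗ q → y q ≤ y p) → (∀ p → row p ≡ n → 0# ≤ y p) → ∀ p → 0# ≤ y p
    lower⇒nonNeg {y} lower top p@(index i j a b c) = climb k p eq
      where
      k  = proj₁ (ℕ.m≤n⇒∃[o]m+o≡n c)
      eq = proj₂ (ℕ.m≤n⇒∃[o]m+o≡n c)
      climb : ∀ k p → row p ℕ.+ k ≡ n → 0# ≤ y p
      climb zero    p eq = top p (≡.trans (≡.sym (ℕ.+-identityʳ _)) eq)
      climb (suc k) (index i j a b c) eq =
        ≤.trans (climb k q (≡.trans (≡.sym (ℕ.+-suc j k)) eq)) (lower (≡.refl , ≡.refl))
        where
        q : Index n
        q = index (suc i) (suc j) (s≤s z≤n) (s≤s b)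
              (ℕ.≤-trans (s≤s (ℕ.m≤m+n j k)) (ℕ.≤-reflexive (≡.trans (≡.sym (ℕ.+-suc j k)) eq)))

    top-agree : ∀ {y z : X n} → y ∈ GT Λ μ → z ∈ GT Λ μ → ∀ p → row p ≡ n → y p ≈ z p
    top-agree {y} {z} y∈ z∈ = entry-elim {P = λ p → row p ≡ n → y p ≈ z p}
      λ { j≤n i ≡.refl → trans (GT.top y∈ i) (sym (GT.top z∈ i)) }

    -- The weights prescribe the differences of successive row sums, so the sums follow by
    -- telescoping from the empty row.
    rowSum-agree : ∀ {y z : X n} → y ∈ GT Λ μ → z ∈ GT Λ μ →
                   ∀ j .(j≤n : j ℕ.≤ n) → rowSum y j j≤n ≈ rowSum z j j≤n
    rowSum-agree y∈ z∈ zero    _   = refl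
    rowSum-agree {y} {z} y∈ z∈ (suc j) j<n = step (fromℕ< j<n) (toℕ-fromℕ< j<n)
      where
      step : (i : Fin n) → toℕ i ≡ j → rowSum y (suc j) j<n ≈ rowSum z (suc j) j<n
      step i ≡.refl = begin
        rowSum y (suc j) _                            ≈⟨ telescope _ _ ⟩
        (rowSum y (suc j) _ - rowSum y j _) + rowSum y j _
          ≈⟨ +-cong (trans (GT.weight y∈ i) (sym (GT.weight z∈ i))) (rowSum-agree y∈ z∈ j (toℕ≤n i)) ⟩
        (rowSum z (suc j) _ - rowSum z j _) + rowSum z j _ ≈⟨ telescope _ _ ⟨
        rowSum z (suc j) _                            ∎
        where
        telescope : ∀ a b → a ≈ (a - b) + b
        telescope = solve 2 (λ a b → a := (a :- b) :+ b) refl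

    module _ {x d : X n} (x∈ : x ∈ GT Λ μ) (D : IsDirection x d) where
      open IsDirection D
      open IsGTPattern (GT.isGTPattern x∈) using (nonNeg; upper; lower)

      -- Only strict inequalities restrict ε: ties between adjacent entries persist for every ε,
      -- since a direction is constant there. All pairs are taken because their number is finite
      -- anyway.
      OrderPreserving : Carrier → Set
      OrderPreserving ε = ∀ p q → x p < x q → (x ⊕ ε ∙ d) p ≤ (x ⊕ ε ∙ d) q

      eventually-orderPreserving : Eventually OrderPreserving
      eventually-orderPreserving = eventually-∀Index λ p → eventually-∀Index λ q → pair p q
        where
        pair : ∀ p q → Eventually (λ ε → x p < x q → (x ⊕ ε ∙ d) p ≤ (x ⊕ ε ∙ d) q)
        pair p q with x p ≤.≟ x q | x p ≤.≤? x q
        ... | yes xp≈xq | _        = eventually-always λ _ xp<xq → contradiction xp≈xq (proj₂ xp<xq)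
        ... | no  _     | no xp≰xq = eventually-always λ _ xp<xq → contradiction (proj₁ xp<xq) xp≰xq
        -- The positive gap `x q - x p` eventually dominates ε times `d p - d q`.
        ... | no  xp≉xq | yes xp≤xq = eventually-map (λ {ε} εD≤g _ → 0≤-⇒≤ (≤.trans (≤⇒0≤- εD≤g)
                (≤.reflexive (solve 5 (λ a b ε c e → (b :- a) :- ε :* (c :- e) := (b :+ ε :* e) :- (a :+ ε :* c))
                  refl (x p) (x q) ε (d p) (d q)))))
                (eventually-≤ (d p - d q) (≤⇒0≤- xp≤xq , λ 0≈ → xp≉xq (-≈0⇒≈ (sym 0≈))))

      orderPreserving⇒∈GT : ∀ {ε} → OrderPreserving ε → (x ⊕ ε ∙ d) ∈ GT Λ μ
      orderPreserving⇒∈GT {ε} mono = record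
        { isGTPattern = record
          { nonNeg = lower⇒nonNeg (λ p↗q → weakly (lower p↗q) (inj₂ (inj₂ (inj₁ p↗q))))
              (λ p top → ≤.trans (nonNeg p) (≤.reflexive (sym (unchanged (top-zero p top)))))
          ; upper  = λ p↖q → weakly (upper p↖q) (inj₂ (inj₁ p↖q))
          ; lower  = λ p↗q → weakly (lower p↗q) (inj₂ (inj₂ (inj₁ p↗q)))
          }
        ; top    = λ i → trans (unchanged (top-zero (entry ℕ.≤-refl i) ≡.refl)) (GT.top x∈ i)
        ; weight = λ j → trans (+-cong (rowSum-⊕ (suc (toℕ j)) (toℕ<n j)) (-‿cong (rowSum-⊕ (toℕ j) (toℕ≤n j))))
                               (GT.weight x∈ j)
        }
        where
        weakly : ∀ {p q} → x p ≤ x q → Adjacent p q → (x ⊕ ε ∙ d) p ≤ (x ⊕ ε ∙ d) q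
        weakly {p} {q} xp≤xq adj with x p ≤.≟ x q
        ... | yes xp≈xq = ≤.reflexive (+-cong xp≈xq (*-congˡ (sym (constant (sym xp≈xq) adj))))
        ... | no  xp≉xq = mono p q (xp≤xq , xp≉xq)

        unchanged : ∀ {a b} → b ≈ 0# → a + ε * b ≈ a
        unchanged b≈0 = trans (+-congˡ (trans (*-congˡ b≈0) (zeroʳ ε))) (+-identityʳ _)

        rowSum-⊕ : ∀ j .(j≤n : j ℕ.≤ n) → rowSum (x ⊕ ε ∙ d) j j≤n ≈ rowSum x j j≤n
        rowSum-⊕ j j≤n = begin
          (∑[ i < j ] (x (e i) + ε * d (e i)))       ≈⟨ sum-cong-≋ (λ i → +-congʳ (*-identityˡ (x (e i)))) ⟨
          (∑[ i < j ] (1# * x (e i) + ε * d (e i)))  ≈⟨ sum-lincomb 1# ε (x ∘ e) (d ∘ e) ⟩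
          1# * rowSum x j j≤n + ε * rowSum d j j≤n   ≈⟨ +-congʳ (*-identityˡ _) ⟩
          rowSum x j j≤n + ε * rowSum d j j≤n        ≈⟨ unchanged (rows-zero j j≤n) ⟩
          rowSum x j j≤n                             ∎
          where
          e : Fin j → Index n
          e = entry j≤n

      eventually-∈GT : Eventually (λ ε → (x ⊕ ε ∙ d) ∈ GT Λ μ)
      eventually-∈GT = eventually-map orderPreserving⇒∈GT eventually-orderPreserving

    midpoint : ∀ {h} → h + h ≈ 1# → ∀ ε a b → a ≈ (1# - h) * (a + ε * b) + h * (a + ε * (- 1# * b))
    midpoint {h} h+h≈1 ε a b = begin
      a                                               ≈⟨ *-identityˡ _ ⟨
      1# * a                                          ≈⟨ *-congʳ h+h≈1 ⟨
      (h + h) * a                                     ≈⟨ solve 3 (λ h a b → (h :+ h) :* a :=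
        ((h :+ h) :- h) :* (a :+ b) :+ h :* (a :- b)) refl h a (ε * b) ⟩
      (h + h - h) * (a + ε * b) + h * (a - ε * b)
        ≈⟨ +-cong (*-congʳ (+-congʳ h+h≈1)) (*-congˡ (+-congˡ
             (solve 2 (λ ε b → :- (ε :* b) := ε :* (con (ℤ.- + 1) :* b)) refl ε b))) ⟩
      (1# - h) * (a + ε * b) + h * (a + ε * (- 1# * b)) ∎

    -- The point `x` is the midpoint of the two displaced points, so extremality makes the
    -- displacement ε times `d` zero, and ε cancels.
    two-sided⇒zero : ∀ {x d : X n} {ε} → IsVertex (GT Λ μ) x → 0# < ε → (x ⊕ ε ∙ d) ∈ GT Λ μ →
                     (x ⊕ ε ∙ (λ p → - 1# * d p)) ∈ GT Λ μ → ∀ p → d p ≈ 0#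
    two-sided⇒zero {x} {d} {ε} (_ , extreme) 0<ε y∈ z∈ p = *-cancel-nonzero (pos⇒≉0 0<ε) (begin
      ε * d p                ≈⟨ solve 2 (λ a b → b := (a :+ b) :- a) refl (x p) (ε * d p) ⟩
      (x p + ε * d p) - x p  ≈⟨ +-congʳ (y≋x half p) ⟩
      x p - x p              ≈⟨ -‿inverseʳ (x p) ⟩
      0#                     ∎)
      where
      y≋x : (∃[ h ] 0# < h × h < 1# × h + h ≈ 1#) → (x ⊕ ε ∙ d) ≋ x
      y≋x (h , 0<h , h<1 , h+h≈1) = proj₁ (extreme y∈ z∈ 0<h h<1 (λ p → midpoint h+h≈1 ε (x p) (d p)))

    vertex⇒direction-zero : ∀ {x d : X n} → IsVertex (GT Λ μ) x → IsDirection x d → ∀ p → d p ≈ 0#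
    vertex⇒direction-zero {x} {d} vertex D =
      let ε , 0<ε , y∈ , z∈ = eventually-witness (eventually-×
            (eventually-∈GT (proj₁ vertex) D) (eventually-∈GT (proj₁ vertex) (negate-direction D)))
      in two-sided⇒zero vertex 0<ε y∈ z∈

    difference-direction : ∀ {x y z : X n} {t} → x ∈ GT Λ μ → y ∈ GT Λ μ → z ∈ GT Λ μ → 0# < t → t < 1# →
      x ≋ (λ p → (1# - t) * y p + t * z p) → IsDirection x (y ⊕ - 1# ∙ x)
    difference-direction {x} {y} {z} {t} x∈ y∈ z∈ 0<t t<1 conv = record
      { constant  = λ eq adj → +-cong (y-constant eq adj) (*-congˡ eq)
      ; top-zero  = λ p top → trans (+-congʳ (top-agree y∈ x∈ p top)) (cancel _)
      ; rows-zero = λ j j≤n → begin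
          rowSum (y ⊕ - 1# ∙ x) j j≤n
            ≈⟨ sum-cong-≋ (λ i → +-congʳ (*-identityˡ (y (entry j≤n i)))) ⟨
          (∑[ i < j ] (1# * y (entry j≤n i) + - 1# * x (entry j≤n i)))
            ≈⟨ sum-lincomb 1# (- 1#) (λ i → y (entry j≤n i)) (λ i → x (entry j≤n i)) ⟩
          1# * rowSum y j j≤n + - 1# * rowSum x j j≤n
            ≈⟨ +-congʳ (trans (*-identityˡ _) (rowSum-agree y∈ x∈ j j≤n)) ⟩
          rowSum x j j≤n + - 1# * rowSum x j j≤n   ≈⟨ cancel _ ⟩
          0# ∎
      }
      where
      cancel : ∀ a → a + - 1# * a ≈ 0#
      cancel = solve 1 (λ a → a :+ con (ℤ.- + 1) :* a := con (+ 0)) refl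

      0<1-t : 0# < 1# - t
      0<1-t = ≤⇒0≤- (proj₁ t<1) , λ 0≈ → proj₂ t<1 (-≈0⇒≈ (sym 0≈))

      -- Between adjacent entries `y` and `z` obey the same inequality, so a tie in `x` forces a tie
      -- in `y`.
      rigid : ∀ {p q} → x p ≈ x q → y p ≤ y q → z p ≤ z q → y p ≈ y q
      rigid {p} {q} xp≈xq yp≤yq zp≤zq =
        combination-rigidˡ 0<1-t 0<t yp≤yq zp≤zq (trans (sym (conv p)) (trans xp≈xq (conv q)))

      y-upper : ∀ {p q} → p ↖ q → y p ≤ y q
      y-upper = IsGTPattern.upper (GT.isGTPattern y∈)
      z-upper : ∀ {p q} → p ↖ q → z p ≤ z q
      z-upper = IsGTPattern.upper (GT.isGTPattern z∈)
      y-lower : ∀ {p q} → p ↗ q → y q ≤ y p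
      y-lower = IsGTPattern.lower (GT.isGTPattern y∈)
      z-lower : ∀ {p q} → p ↗ q → z q ≤ z p
      z-lower = IsGTPattern.lower (GT.isGTPattern z∈)

      y-constant : ∀ {p q} → x q ≈ x p → Adjacent p q → y q ≈ y p
      y-constant eq (inj₁ p↗q)               = rigid eq (y-lower p↗q) (z-lower p↗q)
      y-constant eq (inj₂ (inj₁ p↖q))        = sym (rigid (sym eq) (y-upper p↖q) (z-upper p↖q))
      y-constant eq (inj₂ (inj₂ (inj₁ q↗p))) = sym (rigid (sym eq) (y-lower q↗p) (z-lower q↗p))
      y-constant eq (inj₂ (inj₂ (inj₂ q↖p))) = rigid eq (y-upper q↖p) (z-upper q↖p)

  -- Extreme points and the kernel of the tiling matrix.

  module _ {n} {Λ μ : Vector ℤ n} {x : X n} (x∈ : x ∈ GT Λ μ) {s} (𝒫 : FreeTiles x s) where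
    open Tiling 𝒫
    open Polytope {n} {Λ} {μ}

    trivialKernel⇒vertex : TrivialKernel (tilingMatrix 𝒫) → IsVertex (GT Λ μ) x
    trivialKernel⇒vertex triv = x∈ , λ y∈ z∈ 0<t t<1 conv →
      let y≋x = rigid y∈ z∈ 0<t t<1 conv
      in y≋x , λ p → sym (z-agree 0<t (y≋x p) (conv p))
      where
      rigid : ∀ {y z t} → y ∈ GT Λ μ → z ∈ GT Λ μ → 0# < t → t < 1# →
              x ≋ (λ p → (1# - t) * y p + t * z p) → y ≋ x
      rigid {y} y∈ z∈ 0<t t<1 conv p = begin
        y p                          ≈⟨ solve 2 (λ a b → a := b :+ (a :+ con (ℤ.- + 1) :* b)) refl (y p) (x p) ⟩
        x p + (y p + - 1# * x p)     ≈⟨ +-congˡ (trivialKernel⇒direction-zero triv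
                                          (difference-direction x∈ y∈ z∈ 0<t t<1 conv) p) ⟩
        x p + 0#                     ≈⟨ +-identityʳ _ ⟩
        x p                          ∎

      -- Once `y` is known to equal `x`, the convex combination is solved for `z`, as `t` is
      -- nonzero.
      z-agree : ∀ {a b c t} → 0# < t → b ≈ a → a ≈ (1# - t) * b + t * c → a ≈ c
      z-agree {a} {b} {c} {t} 0<t b≈a eq = sym (-≈0⇒≈ (*-cancel-nonzero (pos⇒≉0 0<t) (begin
        t * (a - c)                        ≈⟨ solve 3 (λ a c t → t :* (a :- c) :=
                                                a :- ((con (+ 1) :- t) :* a :+ t :* c)) refl a c t ⟩
        a - ((1# - t) * a + t * c)         ≈⟨ +-congˡ (-‿cong (trans eq (+-congʳ (*-congˡ b≈a)))) ⟨
        a - a                              ≈⟨ solve 1 (λ a → a :- a := con (+ 0)) refl a ⟩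
        0#                                 ∎)))

    -- The coefficient `v k` is read off from the spread direction at the representative of tile
    -- `k`.
    vertex⇒trivialKernel : IsVertex (GT Λ μ) x → TrivialKernel (tilingMatrix 𝒫)
    vertex⇒trivialKernel vertex v Av≈0 k = trans (sym (spread-∈ v k (representative∈ k)))
      (vertex⇒direction-zero vertex (spread-direction v Av≈0) (representative k))

corollary1p6 : (ℝ : RealNumbers) → let open GelfandTsetlin ℝ in
    ∀ (n : ℕ) (Λ μ : Vector ℤ n) (x : X n) → x ∈ GT Λ μ →
    ∀ (s : ℕ) (𝒫 : FreeTiles x s) →
    (IsVertex (GT Λ μ) x ⇔ TrivialKernel (tilingMatrix 𝒫)) ×
    (TrivialKernel (tilingMatrix 𝒫) ⇔ HasNonsingularMaximalSubmatrix (tilingMatrix 𝒫))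
corollary1p6 ℝ n Λ μ x x∈ s 𝒫 =
  mk⇔ (vertex⇒trivialKernel x∈ 𝒫) (trivialKernel⇒vertex x∈ 𝒫) ,
  mk⇔ (trivialKernel⇒nonsingularSubmatrix (tilingMatrix 𝒫))
      (nonsingularSubmatrix⇒trivialKernel (tilingMatrix 𝒫))
  where
  open GelfandTsetlin ℝ
  open LinearAlgebra ℝ
  open Vertices ℝ
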